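{- For every $\epsilon>0$, no DPTM solves Vertex Cover on a tree, path or treedepth decomposition of width/depth $k$ with space bounded by $O((2-\epsilon)^k\log n)$. (This holds for each of the three types of decomposition.)
   Context: All graphs are finite and simple; logarithms are base two. Vertex Cover: given a graph $G$ and an integer $\xi$, decide whether $G$ has a vertex cover of size at most $\xi$. Tree and path decompositions and their width are the standard notions. Treedepth decomposition: a treedepth decomposition of a graph $G$ is a rooted forest $F$ with vertex set $V(G)$ such that for every edge $uv\in E(G)$ either $u$ is an ancestor of $v$ in $F$ or vice versa. Its depth is its height, counted as the number of vertices on a longest root-to-leaf path. DP decision problem: let $\Pi$ be a decision problem on graphs with instances $(G,\xi)$, where $\xi$ encodes the non-graph part of the input. Let $T$ be a tree, path or treedepth decomposition of $G$ of width/depth $k$. Fix an encoding $\hat T$ of $T$ that lists the separators provided by the decomposition in the order in which they are normally visited in a dynamic programming algorithm (post-order depth-first traversal of the bags/nodes of the decomposition) and that additionally encodes the edges of $G$ contained in a separator using $O(k\log k)$ bits per bag. Then $(k,\hat T,\xi)$ is a well-formed instance of the DP decision problem $\Pi_{\mathrm{DP}}$; it is a yes-instance iff $(G,\xi)\in\Pi$. DPTM: a dynamic programming Turing machine is a Turing machine with a read-only input tape whose head moves only in one direction, and a separate working tape. It accepts as inputs well-formed instances of some DP decision problem. Its space is the space used on the working tape. A DPTM solves $\Pi$ on decompositions of a given type if it decides the corresponding $\Pi_{\mathrm{DP}}$. Here $n$ is the size and $k$ the width/depth of the decomposition given as input. -}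

module Defs where

open import Algebra.Definitions.RawSemiring using (_^_)
open import Data.Bool.Base using (Bool; true; false; T; if_then_else_)
open import Data.Bool.Properties using (T?)
open import Data.Digit using (toDigits)
open import Data.Fin.Base as Fin using (Fin; toℕ)
open import Data.Fin.Subset using (Subset; _∈_; _∪_; ⁅_⁆; ∣_∣) renaming (⊥ to ∅)
open import Data.Fin.Subset.Properties using (_∈?_)
import Data.Fin.Properties as Fin
open import Data.Integer.Base as ℤ using (ℤ; +_; -[1+_])
open import Data.List.Base
  using (List; []; _∷_; _++_; map; concatMap; filter; length; lookup; allFin;
         cartesianProduct; head; drop)
open import Data.List.Extrema.Nat using (max)
open import Data.List.Relation.Unary.All using (All)
open import Data.Maybe.Base using (Maybe)
open import Data.Nat.Base using (ℕ; suc; _+_; _∸_; _⊔_; _≤_)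
open import Data.Nat.Logarithm using (⌈log₂_⌉)
open import Data.Product.Base using (∃-syntax; _×_; _,_; proj₁)
open import Data.Rational.Base as ℚ using (ℚ)
open import Data.Sum.Base using (_⊎_; inj₁; inj₂)
open import Function.Definitions using (Bijective)
open import Relation.Binary.Construct.Closure.Equivalence using (EqClosure)
open import Relation.Binary.Construct.Closure.ReflexiveTransitive using (Star)
open import Relation.Binary.Construct.Closure.Transitive using (TransClosure)
open import Relation.Binary.PropositionalEquality using (_≡_)
open import Relation.Nullary using (¬_)
open import Relation.Nullary.Decidable using (_×-dec_; ¬?)

------------------------------------------------------------------------
-- Graphs and problems

record Graph : Set where
  field
    order     : ℕ
    adjacent  : Fin order → Fin order → Bool
    symmetric : ∀ u v → adjacent u v ≡ adjacent v u
    loopless  : ∀ v → adjacent v v ≡ false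

  Vertex : Set
  Vertex = Fin order

  Adj : Vertex → Vertex → Set
  Adj u v = T (adjacent u v)

open Graph

Problem : Set₁
Problem = Graph → ℤ → Set

IsVertexCover : (G : Graph) → Subset (order G) → Set
IsVertexCover G S = ∀ u v → Adj G u v → u ∈ S ⊎ v ∈ S

VertexCover : Problem
VertexCover G ξ = ∃[ S ] IsVertexCover G S × (+ ∣ S ∣) ℤ.≤ ξ

------------------------------------------------------------------------
-- Rooted ordered forests

data Tree (A : Set) : Set where
  node : A → List (Tree A) → Tree A

Forest : Set → Set
Forest A = List (Tree A)

root : {A : Set} → Tree A → A
root (node a _) = a

children : {A : Set} → Tree A → Forest A
children (node _ f) = f

height : {A : Set} → Forest A → ℕ
height []             = 0
height (node _ g ∷ f) = suc (height g) ⊔ height f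

-- The nodes of a forest are its roots and, recursively, the nodes of the
-- forest of children of each root.
data Node {A : Set} (f : Forest A) : Set where
  here  : Fin (length f) → Node f
  below : (i : Fin (length f)) → Node (children (lookup f i)) → Node f

label : {A : Set} {f : Forest A} → Node f → A
label {f = f} (here i) = root (lookup f i)
label (below i x)      = label x

-- Parent x y: x is the parent of y.
data Parent {A : Set} {f : Forest A} : Node f → Node f → Set where
  here  : ∀ i j → Parent (here i) (below i (here j))
  below : ∀ i {x y} → Parent x y → Parent (below i x) (below i y)

Ancestor : {A : Set} {f : Forest A} → Node f → Node f → Set
Ancestor = TransClosure Parent

data IsPath {A : Set} : Tree A → Set where
  end  : ∀ {a} → IsPath (node a [])
  step : ∀ {a t} → IsPath t → IsPath (node a (t ∷ []))

------------------------------------------------------------------------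
-- Decompositions

-- The tree is rooted and ordered, so that it has a depth-first traversal.
record TreeDecomposition (G : Graph) : Set where
  field
    tree : Tree (Subset (order G))

  Bag : Set
  Bag = Node (tree ∷ [])

  field
    covers-vertices : ∀ v → ∃[ x ] v ∈ label {f = tree ∷ []} x
    covers-edges    : ∀ u v → Adj G u v →
                      ∃[ x ] u ∈ label {f = tree ∷ []} x × v ∈ label x
    -- The nodes whose bags contain v induce a connected subgraph of the tree.
    connected       : ∀ v (x y : Bag) → v ∈ label x → v ∈ label y →
                      EqClosure (λ s t → Parent s t × v ∈ label s × v ∈ label t) x y

-- A path is rooted at one of its two ends.
record PathDecomposition (G : Graph) : Set where
  field
    treeDecomposition : TreeDecomposition G

  open TreeDecomposition treeDecomposition public

  field
    isPath : IsPath tree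

record TreedepthDecomposition (G : Graph) : Set where
  field
    forest          : Forest (Vertex G)
    label-bijective : Bijective _≡_ _≡_ (label {f = forest})
    edges-vertical  : ∀ (x y : Node forest) → Adj G (label x) (label y) →
                      Ancestor x y ⊎ Ancestor y x

data Kind : Set where
  tree path treedepth : Kind

Decomposition : Kind → Graph → Set
Decomposition tree      = TreeDecomposition
Decomposition path      = PathDecomposition
Decomposition treedepth = TreedepthDecomposition

-- Replaces every label by the set of labels on the path from it to its root;
-- the first argument collects the labels already passed.
rootPaths : {n : ℕ} → Subset n → Forest (Fin n) → Forest (Subset n)
rootPaths P []             = []
rootPaths P (node v g ∷ f) =
  node (⁅ v ⁆ ∪ P) (rootPaths (⁅ v ⁆ ∪ P) g) ∷ rootPaths P f

-- The separators provided by a decomposition: the bags, respectively the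
-- vertex sets of the root paths.
separatorForest : ∀ κ {G} → Decomposition κ G → Forest (Subset (order G))
separatorForest tree      D = TreeDecomposition.tree D ∷ []
separatorForest path      D = PathDecomposition.tree D ∷ []
separatorForest treedepth D = rootPaths ∅ (TreedepthDecomposition.forest D)

record Separator (n : ℕ) : Set where
  field
    bag    : Subset n
    above  : Subset n    -- the bag of the parent node, empty at a root
    arity  : ℕ           -- the number of children

open Separator

postorder : {n : ℕ} → Subset n → Forest (Subset n) → List (Separator n)
postorder P []             = []
postorder P (node X g ∷ f) =
  postorder X g ++ record { bag = X ; above = P ; arity = length g } ∷ postorder P f

separators : ∀ κ {G} → Decomposition κ G → List (Separator (order G))
separators κ D = postorder ∅ (separatorForest κ D)

size : ∀ κ {G} → Decomposition κ G → ℕ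
size κ D = length (separators κ D)

bagWidth : {n : ℕ} → List (Separator n) → ℕ
bagWidth ss = max 0 (map (λ s → ∣ bag s ∣) ss) ∸ 1

width : ∀ κ {G} → Decomposition κ G → ℕ
width tree      D = bagWidth (separators tree D)
width path      D = bagWidth (separators path D)
width treedepth D = height (TreedepthDecomposition.forest D)

------------------------------------------------------------------------
-- The encoding

-- Each edge of the graph is listed with the topmost separator that contains it,
-- i.e. with the one whose parent's bag does not contain it. Endpoints are given
-- by their positions in the increasing list of the vertices of the bag.

members : {n : ℕ} → Subset n → List (Fin n)
members X = filter (_∈? X) (allFin _)

listedEdges : (G : Graph) (s : Separator (order G)) →
              List (Fin (length (members (bag s))) × Fin (length (members (bag s))))
listedEdges G s = filter listed? (cartesianProduct (allFin _) (allFin _))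
  where
  vertex = lookup (members (bag s))

  listed? = λ (i , j) →
    (i Fin.<? j) ×-dec T? (adjacent G (vertex i) (vertex j)) ×-dec
    ¬? ((vertex i ∈? above s) ×-dec (vertex j ∈? above s))

-- With at most k edges in each list, and O(log k) bits for each position, the
-- edges take O(k log k) bits per bag. A graph on a single bag may need Θ(k²)
-- bits, so some restriction on the decomposition is unavoidable. This one holds
-- for every treedepth decomposition, where a vertex is listed with its edges to
-- its ancestors, and for every tree or path decomposition in which each bag has
-- at most one vertex outside the bag of its parent, the parent's bag being
-- empty for the root. Every tree decomposition can be refined to such a
-- decomposition without increasing its width.
Compact : ∀ κ {G} → Decomposition κ G → Set
Compact κ {G} D = All (λ s → length (listedEdges G s) ≤ width κ D) (separators κ D)

data Symbol : Set where
  digit                           : Fin 2 → Symbol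
  comma colon bar hash plus minus : Symbol

-- Binary, least significant digit first.
numeral : ℕ → List Symbol
numeral n = map digit (proj₁ (toDigits 2 n))

item : {n : ℕ} → Fin n → List Symbol
item i = numeral (toℕ i) ++ comma ∷ []

-- A post-order listing with arities determines the ordered forest.
encodeSeparator : (G : Graph) → Separator (order G) → List Symbol
encodeSeparator G s =
  numeral (arity s) ++ colon ∷
  concatMap item (members (bag s)) ++ bar ∷
  concatMap (λ (i , j) → item i ++ item j) (listedEdges G s) ++ hash ∷ []

encodeℤ : ℤ → List Symbol
encodeℤ (+ n)    = plus ∷ numeral n
encodeℤ -[1+ n ] = minus ∷ numeral (suc n)

record Instance (κ : Kind) : Set where
  field
    graph         : Graph
    decomposition : Decomposition κ graph
    compact       : Compact κ decomposition
    ξ             : ℤ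

  k : ℕ
  k = width κ decomposition

  n : ℕ
  n = size κ decomposition

  encoding : List Symbol
  encoding =
    numeral k ++ hash ∷
    concatMap (encodeSeparator graph) (separators κ decomposition) ++
    encodeℤ ξ

------------------------------------------------------------------------
-- Dynamic programming Turing machines

data Direction : Set where
  left stay right : Direction

-- go q a d b: enter state q, write a, move the working head in direction d, and
-- advance the input head iff b is true.
data Action (Q Γ : Set) : Set where
  halt : Bool → Action Q Γ
  go   : Q → Γ → Direction → Bool → Action Q Γ

-- State 0 is initial and working symbol 0 is blank. The input symbol is nothing
-- once the input is exhausted.
record DPTM : Set where
  field
    states  : ℕ
    symbols : ℕ

  State : Set
  State = Fin (suc states)

  WorkSymbol : Set
  WorkSymbol = Fin (suc symbols)

  field
    δ : State → Maybe Symbol → WorkSymbol → Action State WorkSymbol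

-- The visited part of a two-way infinite tape, both sides listed outwards from
-- the head. It never shrinks.
record Tape (Γ : Set) : Set where
  constructor tape
  field
    toLeft  : List Γ
    scanned : Γ
    toRight : List Γ

move : {Γ : Set} → Γ → Direction → Tape Γ → Tape Γ
move blank left  (tape []       a rs)       = tape [] blank (a ∷ rs)
move blank left  (tape (l ∷ ls) a rs)       = tape ls l (a ∷ rs)
move blank stay  t                          = t
move blank right (tape ls       a [])       = tape (a ∷ ls) blank []
move blank right (tape ls       a (r ∷ rs)) = tape (a ∷ ls) r rs

module _ (M : DPTM) where
  open DPTM M

  record Configuration : Set where
    constructor config
    field
      state  : State
      unread : List Symbol
      work   : Tape WorkSymbol

  open Configuration

  initial : List Symbol → Configuration
  initial w = config Fin.zero w (tape [] Fin.zero [])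

  perform : Action State WorkSymbol → Configuration → Configuration ⊎ Bool
  perform (halt b)     c = inj₂ b
  perform (go q a d b) (config _ w (tape ls _ rs)) =
    inj₁ (config q (if b then drop 1 w else w) (move Fin.zero d (tape ls a rs)))

  next : Configuration → Configuration ⊎ Bool
  next c = perform (δ (state c) (head (unread c)) (Tape.scanned (work c))) c

  Reachable : List Symbol → Configuration → Set
  Reachable w = Star (λ c c′ → next c ≡ inj₁ c′) (initial w)

  Answers : List Symbol → Bool → Set
  Answers w b = ∃[ c ] Reachable w c × next c ≡ inj₂ b

  space : Configuration → ℕ
  space c = length (Tape.toLeft (work c)) + suc (length (Tape.toRight (work c)))

Solves : Problem → Kind → DPTM → Set
Solves Π κ M = ∀ (I : Instance κ) → let open Instance I in
  (Π graph ξ → Answers M encoding true) × (¬ Π graph ξ → Answers M encoding false)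

fromℕ : ℕ → ℚ
fromℕ m = (+ m) ℚ./ 1

-- Space O(b k n), where the bound only has to hold once both k and n are large.
SpaceO : (ℕ → ℕ → ℚ) → Kind → DPTM → Set
SpaceO b κ M =
  ∃[ C ] ∃[ N ] ∀ (I : Instance κ) → let open Instance I in
    N ≤ k → N ≤ n → ∀ c → Reachable M encoding c →
    fromℕ (space M c) ℚ.≤ fromℕ C ℚ.* b k n

-- a ^ k · log n. Rounding the logarithm up changes it by a factor below two for
-- n ≥ 2.
exponentialTimesLog : ℚ → ℕ → ℕ → ℚ
exponentialTimesLog a k n = (a ^ℚ k) ℚ.* fromℕ ⌈log₂ n ⌉
  where _^ℚ_ = _^_ ℚ.+-*-rawSemiring

module Submission where

-- A machine that reads an instance in two parts can only remember, about the first part, its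
-- state and its working tape. Take w = q² boundary vertices, contained in almost every bag.
-- The first part encodes a family I of j-element sets of boundary vertices: the gadget of x
-- costs one vertex more than usual iff x belongs to I and the cover meets the boundary only
-- inside x. The second part asks for a j-element set X by a pendant neighbour at each of its
-- vertices. The minimum vertex cover then has size budget X or budget X + 1, the latter iff
-- X belongs to I. Letting j run from 0 to w, all 2^(2^w) families of sets must be separated by
-- w + 1 configurations, which forces about 2^w / w cells of tape. A gadget tests the
-- disjunction "some boundary vertex outside x is covered" with cliques of sizes q and q + 1
-- only, so the depth is (q + 1)² = w + O(√w) and log n = O(w); since (2 - ε)^(w + O(√w)) w²
-- is of smaller order than 2^w, the space bound fails.

open import Defs
open import Algebra.Bundles using (CommutativeMonoid)
open import Data.Bool.Base using (Bool; true; false; T; not; _∧_)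
open import Data.Bool.Properties using (T?; T-∧; T-≡)
open import Data.Empty using (⊥; ⊥-elim)
open import Data.Fin.Base as Fin
  using (Fin; zero; suc; toℕ; fromℕ<; combine; remQuot; join; splitAt; punchOut; funToFin; finToFun)
open import Data.Fin.Properties as Fin
  using (any?; combine-injective; combine-remQuot; splitAt-join; toℕ-fromℕ<;
         finToFun-funToFin; funToFin-finToFin; injective⇒≤)
open import Data.Fin.Subset using (Subset; _∈_; _∉_; _⊆_; _∪_; ⁅_⁆; ∣_∣) renaming (⊥ to ∅)
open import Data.Fin.Subset.Properties
  using (_∈?_; x∈⁅x⁆; x∈⁅y⁆⇒x≡y; x∈p∪q⁻; p⊆p∪q; q⊆p∪q; ∪-identityˡ; ∉⊥; ∣⊥∣≡0)
open import Data.Integer.Base as ℤ using (ℤ; +_; -[1+_])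
import Data.Integer.Properties as ℤ
open import Data.List.Base as List
  using (List; []; _∷_; _++_; map; length; lookup; reverse; concat; concatMap; allFin; tabulate;
         filter; cartesianProduct)
open import Data.List.Extrema.Nat using (max; max≤v⁺; v≤max⁺)
open import Data.List.Membership.Propositional using () renaming (_∈_ to _∈ˡ_; _∉_ to _∉ˡ_)
open import Data.List.Membership.Propositional.Properties
  using (∈-++⁺ˡ; ∈-++⁺ʳ; ∈-++⁻; ∈-lookup; ∈-map⁺; ∈-map⁻; ∈-filter⁻; ∈-allFin; ∈-concatMap⁺; ∈-concatMap⁻)
open import Data.List.Properties
  using (∷-injectiveˡ; ∷-injectiveʳ; ++-assoc; ++-identityʳ; length-++; length-map; length-tabulate;
         map-++; map-∘; map-cong; map-cong-local; map-tabulate; tabulate-lookup; filter-≐;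
         concatMap-++; concatMap-cong; reverse-++; unfold-reverse)
open import Data.List.Relation.Binary.Disjoint.Propositional using (Disjoint)
open import Data.List.Relation.Unary.All as All using (All; []; _∷_)
import Data.List.Relation.Unary.All.Properties as All
open import Data.List.Relation.Unary.AllPairs as AllPairs using (AllPairs; []; _∷_)
import Data.List.Relation.Unary.AllPairs.Properties as AllPairs
open import Data.List.Relation.Unary.Any as Any using (Any; here; there; index)
import Data.List.Relation.Unary.Any.Properties as Any
open import Data.List.Relation.Unary.Unique.Propositional using (Unique)
import Data.List.Relation.Unary.Unique.Propositional.Properties as Unique
open import Data.Maybe.Base using (just)
open import Data.Nat.Base as ℕ using (ℕ; zero; suc; s≤s; z≤n; NonZero; >-nonZero; _⊔_)
import Data.Nat.Coprimality as Coprime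
open import Data.Nat.DivMod using (_/_; m/n*n≤m; m*n/n≡m; /-monoˡ-≤)
import Data.Nat.ListAction as ListAction
open import Data.Nat.ListAction.Properties using (sum-++)
open import Data.Nat.Logarithm using (⌈log₂_⌉; ⌈log₂⌉-mono-≤; ⌈log₂2^n⌉≡n)
import Data.Nat.Properties as ℕ
open import Data.Nat.Solver using (module +-*-Solver)
open import Data.Product.Base using (∃-syntax; ∃₂; _×_; _,_; proj₁; proj₂)
import Data.Rational.Base as ℚ
import Data.Rational.Properties as ℚ
open import Data.Rational.Unnormalised as ℚᵘ using (mkℚᵘ; *≡*)
import Data.Rational.Unnormalised.Properties as ℚᵘ
open import Data.Sum.Base as Sum using (_⊎_; inj₁; inj₂; [_,_]′)
open import Data.Sum.Properties using (inj₁-injective; inj₂-injective)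
open import Data.Unit.Base using (⊤)
open import Data.Vec.Base as Vec using ([]; _∷_; here; there)
import Data.Vec.Properties as Vec
open import Function.Base using (_∘_; id)
open import Function.Bundles using (Equivalence)
open import Relation.Binary.Construct.Closure.Equivalence as Eq using (EqClosure)
open import Relation.Binary.Construct.Closure.ReflexiveTransitive as Star using (Star; _◅_; _◅◅_)
open import Relation.Binary.Construct.Closure.Symmetric using (bwd)
open import Relation.Binary.Construct.Closure.Transitive using ([_]; _∷_)
open import Relation.Binary.PropositionalEquality
open import Relation.Nullary using (¬_; Dec; yes; no; does; contradiction)
open import Relation.Nullary.Decidable
  using (⌊_⌋; map′; _×-dec_; _⊎-dec_; ¬?; decidable-stable; toWitness; fromWitness; dec-false)
open import Algebra.Properties.CommutativeMonoid.Sum ℕ.+-0-commutativeMonoid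
  using (sum; sum-cong-≗; ∑-distrib-+)
open import Algebra.Properties.CommutativeSemigroup
  (CommutativeMonoid.commutativeSemigroup ℚ.*-1-commutativeMonoid) using (interchange; xy∙z≈xz∙y)

-- Sets of one fixed size are used because a gadget tests inclusion, not equality: gadget x is
-- violated as soon as the boundary part of the cover lies inside x, so a proper superset of X in
-- the family would spoil X as well. Sets of equal size are incomparable. Hence, if X is missing,
-- each x of the family omits an element of X, and covering exactly X on the boundary satisfies all
-- gadgets. One clique with a vertex for each of the w choices would test the same disjunction, but
-- it would double the depth, and (2 - ε)^(2w) exceeds 2^w for small ε. Choosing a row and then a
-- column adds only 2q + 1 levels, because the cliques of different rows can hang side by side.
-- Gadgets and asking vertices are present in every graph, and only edges are switched. So the
-- vertices, the decomposition and the order of the bags are the same throughout, and the threshold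
-- depends on X alone. One cut of the input then has the family on its left, and the question with
-- its threshold on its right.

module Discrete where
  open import Data.Nat.Base using (_+_; _*_; _^_; _∸_; _≤_; _<_)

  private variable
    A B : Set
    n : ℕ

  -- One-way machines on an input cut in two, and the number of their outcomes.

  module Crossing (M : DPTM) where
    open DPTM M

    Step : Configuration M → Configuration M → Set
    Step c c′ = next M c ≡ inj₁ c′

    -- What a run does to the part of the input that precedes a suffix: it either
    -- halts there, or enters the suffix in some state and with some tape.
    Outcome : Set
    Outcome = Bool ⊎ (State × Tape WorkSymbol)

    Leads : Configuration M → List Symbol → Outcome → Set
    Leads c w (inj₁ b)       = ∃[ c′ ] Star Step c c′ × next M c′ ≡ inj₂ b
    Leads c w (inj₂ (q , t)) = Star Step c (config q w t)

    prepend : ∀ {c c₁ w} o → Step c c₁ → Leads c₁ w o → Leads c w o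
    prepend (inj₁ b) e (c′ , r , h) = c′ , e ◅ r , h
    prepend (inj₂ _) e r            = e ◅ r

    -- While some of `p` is unread, the scanned input symbol comes from `p`, so each step is valid
    -- before every continuation `w′`. The given halting run is what the recursion descends on: it
    -- rules out that the machine loops inside `p`.
    crossing : ∀ p q t {w c b} → Star Step (config q (p ++ w) t) c → next M c ≡ inj₂ b →
               ∃[ o ] ∀ w′ → Leads (config q (p ++ w′) t) w′ o
    crossing []      q t r h = inj₂ (q , t) , λ _ → Star.ε
    crossing (x ∷ p) q t {w} {b = b} r h with δ q (just x) (Tape.scanned t) in eq
    crossing (x ∷ p) q t Star.ε h | halt b′ rewrite eq =
      inj₁ b′ , λ w′ → _ , Star.ε , cong (λ a → perform M a (config q (x ∷ p ++ w′) t)) eq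
    crossing (x ∷ p) q t (e ◅ r) h | halt b′ rewrite eq with () ← e
    crossing (x ∷ p) q t Star.ε h | go q′ a d adv rewrite eq with () ← h
    crossing (x ∷ p) q t (e ◅ r) h | go q′ a d true rewrite eq with refl ← e =
      let o , L = crossing p q′ _ r h in
      o , λ w′ → prepend o (cong (λ a → perform M a (config q (x ∷ p ++ w′) t)) eq) (L w′)
    crossing (x ∷ p) q t (e ◅ r) h | go q′ a d false rewrite eq with refl ← e =
      let o , L = crossing (x ∷ p) q′ _ r h in
      o , λ w′ → prepend o (cong (λ a → perform M a (config q (x ∷ p ++ w′) t)) eq) (L w′)

    -- Determinism makes two runs from one configuration comparable; the run that ends where the
    -- machine halts is the longer one.
    confluent : ∀ {c c₁ c₂ b} → Star Step c c₁ → Star Step c c₂ → next M c₂ ≡ inj₂ b →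
                Star Step c₁ c₂
    confluent Star.ε       r        h = r
    confluent (e ◅ _) Star.ε        h with () ← trans (sym e) h
    confluent (e ◅ r) (e′ ◅ s) h with refl ← inj₁-injective (trans (sym e) e′) = confluent r s h

    answers-unique : ∀ {w b b′} → Answers M w b → Answers M w b′ → b ≡ b′
    answers-unique (c , r , h) (c′ , r′ , h′) with confluent r r′ h′
    ... | Star.ε     = inj₂-injective (trans (sym h) h′)
    ... | e ◅ _ with () ← trans (sym e) h

    -- The fooling step. By confluence the run from `u` passes through the configuration at the cut,
    -- and what follows can be spliced onto the run from `v`. If the machine halts before the cut,
    -- uniqueness of answers settles it.
    same-outcome : ∀ {u v w b} o → Leads (initial M u) w o → Leads (initial M v) w o →
                   Answers M u b → Answers M v b
    same-outcome (inj₁ b) L L′ A with refl ← answers-unique L A = L′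
    same-outcome (inj₂ _) L L′ (c , r , h) = c , L′ ◅◅ confluent L r h , h

    module Code (s : ℕ) where
      -- Digit zero stands for an absent cell, hence one digit more than work symbols: a visited
      -- blank cell and a cell never visited must get different codes.
      side : ∀ t → List WorkSymbol → Fin (suc (suc symbols) ^ t)
      side 0       _        = Fin.zero
      side (suc t) []       = combine {suc (suc symbols)} Fin.zero (side t [])
      side (suc t) (x ∷ xs) = combine (Fin.suc x) (side t xs)

      side-injective : ∀ t xs ys → length xs ≤ t → length ys ≤ t → side t xs ≡ side t ys → xs ≡ ys
      side-injective 0       []       []       _ _ _  = refl
      side-injective (suc t) []       []       _ _ _  = refl
      side-injective (suc t) []       (y ∷ ys) _ _ eq
        with () ← proj₁ (combine-injective {suc (suc symbols)} Fin.zero _ (Fin.suc y) _ eq)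
      side-injective (suc t) (x ∷ xs) []       _ _ eq
        with () ← proj₁ (combine-injective {suc (suc symbols)} (Fin.suc x) _ Fin.zero _ eq)
      side-injective (suc t) (x ∷ xs) (y ∷ ys) (s≤s p) (s≤s q) eq
        with refl , eq′ ← combine-injective (Fin.suc x) _ (Fin.suc y) _ eq =
        cong (x ∷_) (side-injective t xs ys p q eq′)

      sides : ℕ
      sides = suc (suc symbols) ^ s

      Fits : Outcome → Set
      Fits (inj₁ _)                  = ℕ.zero ≤ s
      Fits (inj₂ (q , tape ls a rs)) = length ls ℕ.+ suc (length rs) ≤ s

      outcomes : ℕ
      outcomes = 2 ℕ.+ suc states ℕ.* (suc symbols ℕ.* (sides ℕ.* sides))

      codeBool : Bool → Fin 2
      codeBool false = Fin.zero
      codeBool true  = Fin.suc Fin.zero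

      split : Outcome → Fin 2 ⊎ Fin (suc states ℕ.* (suc symbols ℕ.* (sides ℕ.* sides)))
      split (inj₁ b)                  = inj₁ (codeBool b)
      split (inj₂ (q , tape ls a rs)) = inj₂ (combine q (combine a (combine (side s ls) (side s rs))))

      code : Outcome → Fin outcomes
      code o = join 2 _ (split o)

      split-injective : ∀ o o′ → Fits o → Fits o′ → split o ≡ split o′ → o ≡ o′
      split-injective (inj₁ false) (inj₁ false) _ _ _ = refl
      split-injective (inj₁ true)  (inj₁ true)  _ _ _ = refl
      split-injective (inj₁ false) (inj₁ true)  _ _ ()
      split-injective (inj₁ true)  (inj₁ false) _ _ ()
      split-injective (inj₂ (q , tape ls a rs)) (inj₂ (q′ , tape ls′ a′ rs′)) F F′ eq
        with refl , eq₁ ← combine-injective q _ q′ _ (inj₂-injective eq)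
        with refl , eq₂ ← combine-injective a _ a′ _ eq₁
        with l , r ← combine-injective (side s ls) (side s rs) (side s ls′) (side s rs′) eq₂
        with refl ← side-injective s ls ls′ (ℕ.m+n≤o⇒m≤o _ F) (ℕ.m+n≤o⇒m≤o _ F′) l
        with refl ← side-injective s rs rs′ (ℕ.<⇒≤ (ℕ.m+n≤o⇒n≤o (length ls) F)) (ℕ.<⇒≤ (ℕ.m+n≤o⇒n≤o (length ls) F′)) r
        = refl

      code-injective : ∀ o o′ → Fits o → Fits o′ → code o ≡ code o′ → o ≡ o′
      code-injective o o′ F F′ eq = split-injective o o′ F F′
        (trans (sym (splitAt-join 2 _ (split o))) (trans (cong (splitAt 2) eq) (splitAt-join 2 _ (split o′))))

  -- Counting functions, and cardinalities as sums of truth values.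

  funToFin-cong : ∀ {m n} {f g : Fin m → Fin n} → f ≗ g → funToFin f ≡ funToFin g
  funToFin-cong {zero}  e = refl
  funToFin-cong {suc m} e = cong₂ combine (e zero) (funToFin-cong (e ∘ suc))

  finToFun-injective : ∀ {m n} {i j : Fin (m ^ n)} → finToFun {m} {n} i ≗ finToFun j → i ≡ j
  finToFun-injective {m} {n} {i} {j} e =
    trans (sym (funToFin-finToFin {n} {m} i)) (trans (funToFin-cong e) (funToFin-finToFin {n} {m} j))

  -- Numbering the functions on both sides turns pointwise injectivity into an injection from
  -- `Fin (a ^ m)` to `Fin (b ^ l)`.
  functions-≤ : ∀ {a m b l} (f : (Fin m → Fin a) → Fin l → Fin b) →
                (∀ g h → f g ≗ f h → g ≗ h) → a ^ m ≤ b ^ l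
  functions-≤ {a} {m} {b} {l} f inj = injective⇒≤ {f = funToFin ∘ f ∘ finToFun {a} {m}} λ {i} {j} e →
    finToFun-injective {a} {m} (inj _ _ λ t →
      trans (sym (finToFun-funToFin (f (finToFun i)) t))
        (trans (cong (λ z → finToFun z t) e) (finToFun-funToFin (f (finToFun j)) t)))

  sum-mono-≤ : ∀ {n} {f g : Fin n → ℕ} → (∀ i → f i ≤ g i) → sum f ≤ sum g
  sum-mono-≤ {zero}  h = z≤n
  sum-mono-≤ {suc n} h = ℕ.+-mono-≤ (h zero) (sum-mono-≤ (h ∘ suc))

  sum-mono-< : ∀ {n} {f g : Fin n → ℕ} → (∀ i → f i ≤ g i) → ∀ i → f i < g i → sum f < sum g
  sum-mono-< h zero    l = ℕ.+-mono-<-≤ l (sum-mono-≤ (h ∘ suc))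
  sum-mono-< h (suc i) l = ℕ.+-mono-≤-< (h zero) (sum-mono-< (h ∘ suc) i l)

  sum-const : ∀ n c → sum {n} (λ _ → c) ≡ n * c
  sum-const zero    c = refl
  sum-const (suc n) c = cong (ℕ._+_ c) (sum-const n c)

  bit : Bool → ℕ
  bit true  = 1
  bit false = 0

  bit-mono : ∀ {a b} → (T a → T b) → bit a ≤ bit b
  bit-mono {true}  {true}  h = ℕ.≤-refl
  bit-mono {true}  {false} h = ⊥-elim (h _)
  bit-mono {false}         h = z≤n

  bit-< : ∀ {a b} → ¬ T a → T b → bit a < bit b
  bit-< {true}         ¬a _ = ⊥-elim (¬a _)
  bit-< {false} {true} _  _ = ℕ.≤-refl

  bit-≤1 : ∀ b → bit b ≤ 1
  bit-≤1 true  = ℕ.≤-refl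
  bit-≤1 false = z≤n

  bit-true : ∀ {b} → T b → bit b ≡ 1
  bit-true {true} _ = refl

  full : ∀ {n} {f : Fin n → Bool} → (∀ i → T (f i)) → sum (bit ∘ f) ≡ n
  full {n} h = trans (sum-cong-≗ {n} (bit-true ∘ h)) (trans (sum-const n 1) (ℕ.*-identityʳ n))

  sum-bit-≤ : ∀ {n} (f : Fin n → Bool) → sum (bit ∘ f) ≤ n
  sum-bit-≤ {n} f = ℕ.≤-trans (sum-mono-≤ (bit-≤1 ∘ f)) (ℕ.≤-reflexive (trans (sum-const n 1) (ℕ.*-identityʳ n)))

  full-or-missing : ∀ {n} (f : Fin n → Bool) → (∃[ i ] ¬ T (f i)) ⊎ sum (bit ∘ f) ≡ n
  full-or-missing f with any? (λ i → ¬? (T? (f i)))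
  ... | yes m = inj₁ m
  ... | no ¬m = inj₂ (full λ i → decidable-stable (T? (f i)) (λ ¬t → ¬m (i , ¬t)))

  -- A cover of a clique misses at most one vertex: once the first is missing, all others are
  -- forced.
  clique-cover : ∀ {n} (f : Fin n → Bool) → (∀ i j → i ≢ j → T (f i) ⊎ T (f j)) →
                 n ≤ suc (sum (bit ∘ f))
  clique-cover {zero}  f h = z≤n
  clique-cover {suc n} f h with f zero in eq
  ... | true  = s≤s (clique-cover (f ∘ suc) λ i j i≢j → h (suc i) (suc j) (i≢j ∘ Fin.suc-injective))
  ... | false = s≤s (ℕ.≤-reflexive (sym (full λ i →
    [ (λ t → ⊥-elim (subst T eq t)) , (λ t → t) ]′ (h zero (suc i) λ ()))))

  all-but-one : ∀ {n} (i : Fin (suc n)) → sum (λ j → bit (not (does (j Fin.≟ i)))) ≡ n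
  all-but-one {n} zero    = full {n} λ _ → _
  all-but-one {suc n} (suc i) = cong suc (all-but-one i)

  -- A proper inclusion would make the sums differ. This is why sets of one size form an antichain.
  equal-sums : ∀ {n} (f g : Fin n → Bool) → (∀ i → T (f i) → T (g i)) →
               sum (bit ∘ f) ≡ sum (bit ∘ g) → ∀ i → T (g i) → T (f i)
  equal-sums f g f⊆g e i gi = decidable-stable (T? (f i)) λ ¬fi →
    ℕ.<-irrefl e (sum-mono-< (λ j → bit-mono (f⊆g j)) i (bit-< ¬fi gi))

  -- The gadgets and the exact cost of their vertex covers.

  -- The boundary consists of (1 + p)² vertices, arranged in rows.
  module Gadgets (p N : ℕ) (mem : Fin N → Fin (suc p * suc p) → Bool) where

    data V : Set where
      bd   : Fin (suc p * suc p) → V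
      hub  : Fin N → Fin (suc p) → V
      cell : Fin N → Fin (suc p) → Fin (suc (suc p)) → V
      ask  : Fin (suc p * suc p) → V

    -- Gadget x chooses, by the vertex it leaves uncovered, a row r in its hub
    -- clique and then a column s in the clique of that row. If it is on, that
    -- choice is free of charge only if the boundary vertex in row r and column s
    -- is covered and does not belong to x.
    data Edge (on : Fin N → Bool) (X : Fin (suc p * suc p) → Bool) : V → V → Set where
      hubs    : ∀ {x r r′} → r ≢ r′ → Edge on X (hub x r) (hub x r′)
      cells   : ∀ {x r s s′} → s ≢ s′ → Edge on X (cell x r s) (cell x r s′)
      row     : ∀ {x r} → Edge on X (cell x r zero) (hub x r)
      blocked : ∀ {x r s} → T (on x) → T (mem x (combine r s)) → Edge on X (cell x r (suc s)) (hub x r)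
      column  : ∀ {x r s} → T (on x) → ¬ T (mem x (combine r s)) →
                Edge on X (cell x r (suc s)) (bd (combine r s))
      asked   : ∀ {i} → T (X i) → Edge on X (ask i) (bd i)

    module _ (on : Fin N → Bool) (X : Fin (suc p * suc p) → Bool) where

      edge? : ∀ u v → Dec (Edge on X u v)
      edge? (bd i) (bd j) = no λ ()
      edge? (bd i) (hub x r) = no λ ()
      edge? (bd i) (cell x r s) = no λ ()
      edge? (bd i) (ask j) = no λ ()
      edge? (hub x r) (bd i) = no λ ()
      edge? (hub x r) (hub y r′) =
        map′ (λ { (refl , n) → hubs n }) (λ { (hubs n) → refl , n })
          (x Fin.≟ y ×-dec ¬? (r Fin.≟ r′))
      edge? (hub x r) (cell y r′ s) = no λ ()
      edge? (hub x r) (ask i) = no λ ()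
      edge? (cell x r zero) (bd i) = no λ ()
      edge? (cell x r (suc s)) (bd i) =
        map′ (λ { (o , n , refl) → column o n }) (λ { (column o n) → o , n , refl })
          (T? (on x) ×-dec ¬? (T? (mem x (combine r s))) ×-dec combine r s Fin.≟ i)
      edge? (cell x r zero) (hub y r′) =
        map′ (λ { (refl , refl) → row }) (λ { row → refl , refl }) (x Fin.≟ y ×-dec r Fin.≟ r′)
      edge? (cell x r (suc s)) (hub y r′) =
        map′ (λ { (refl , refl , o , m) → blocked o m }) (λ { (blocked o m) → refl , refl , o , m })
          (x Fin.≟ y ×-dec r Fin.≟ r′ ×-dec T? (on x) ×-dec T? (mem x (combine r s)))
      edge? (cell x r s) (cell y r′ s′) =
        map′ (λ { (refl , refl , n) → cells n }) (λ { (cells n) → refl , refl , n })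
          (x Fin.≟ y ×-dec r Fin.≟ r′ ×-dec ¬? (s Fin.≟ s′))
      edge? (cell x r s) (ask i) = no λ ()
      edge? (ask i) (bd j) =
        map′ (λ { (refl , a) → asked a }) (λ { (asked a) → refl , a }) (i Fin.≟ j ×-dec T? (X i))
      edge? (ask i) (hub x r) = no λ ()
      edge? (ask i) (cell x r s) = no λ ()
      edge? (ask i) (ask j) = no λ ()

      Covers : (V → Bool) → Set
      Covers χ = ∀ {u v} → Edge on X u v → T (χ u) ⊎ T (χ v)

    irreflexive : ∀ {on X v} → ¬ Edge on X v v
    irreflexive (hubs n)  = n refl
    irreflexive (cells n) = n refl

    gadgetCost : (V → Bool) → Fin N → ℕ
    gadgetCost χ x = sum (λ r → bit (χ (hub x r))) + sum (λ r → sum (λ s → bit (χ (cell x r s))))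

    cost : (V → Bool) → ℕ
    cost χ = sum (λ i → bit (χ (bd i))) + (sum (gadgetCost χ) + sum (λ i → bit (χ (ask i))))

    weight : (Fin (suc p * suc p) → Bool) → ℕ
    weight X = sum (bit ∘ X)

    -- `p` for the hub clique on `1 + p` vertices, and `1 + p` for each of the `1 + p` row cliques
    -- on `2 + p` vertices. The cliques are there in gadgets that are off, too, so `budget` is
    -- independent of `on`.
    base : ℕ
    base = p + suc p * suc p

    budget : (Fin (suc p * suc p) → Bool) → ℕ
    budget X = weight X + N * base

    module _ {on X} {χ : V → Bool} (covers : Covers on X χ) where

      hub-≥ : ∀ x → p ≤ sum (λ r → bit (χ (hub x r)))
      hub-≥ x = ℕ.s≤s⁻¹ (clique-cover (λ r → χ (hub x r)) λ r r′ n → covers (hubs n))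

      row-≥ : ∀ x r → suc p ≤ sum (λ s → bit (χ (cell x r s)))
      row-≥ x r = ℕ.s≤s⁻¹ (clique-cover (λ s → χ (cell x r s)) λ s s′ n → covers (cells n))

      rows-≥ : ∀ x → suc p * suc p ≤ sum (λ r → sum (λ s → bit (χ (cell x r s))))
      rows-≥ x = ℕ.≤-trans (ℕ.≤-reflexive (sym (sum-const (suc p) (suc p)))) (sum-mono-≤ (row-≥ x))

      gadget-≥ : ∀ x → base ≤ gadgetCost χ x
      gadget-≥ x = ℕ.+-mono-≤ (hub-≥ x) (rows-≥ x)

      -- A fully covered hub clique already costs one extra. Otherwise some hub vertex is uncovered
      -- and forces its whole row: cell `zero` through `row`, columns in x through `blocked`, and
      -- the others through `column`, as their boundary vertices are uncovered.
      gadget-> : ∀ x → T (on x) → (∀ i → T (χ (bd i)) → T (mem x i)) → base < gadgetCost χ x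
      gadget-> x o inside with full-or-missing (λ r → χ (hub x r))
      ... | inj₂ f = ℕ.+-mono-≤ {suc p} (ℕ.≤-reflexive (sym f)) (rows-≥ x)
      ... | inj₁ (r , ¬h) = ℕ.+-mono-≤-< (hub-≥ x)
        (ℕ.≤-<-trans (ℕ.≤-reflexive (sym (sum-const (suc p) (suc p))))
          (sum-mono-< (row-≥ x) r (ℕ.≤-reflexive (sym (full covered)))))
        where
        covered : ∀ s → T (χ (cell x r s))
        covered zero = [ id , (λ h → contradiction h ¬h) ]′ (covers row)
        covered (suc s) with T? (mem x (combine r s))
        ... | yes m = [ id , (λ h → contradiction h ¬h) ]′ (covers (blocked o m))
        ... | no ¬m = [ id , (λ b → contradiction (inside _ b) ¬m) ]′ (covers (column o ¬m))

      asked-≥ : ∀ i → bit (X i) ≤ bit (χ (bd i)) + bit (χ (ask i))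
      asked-≥ i with X i in eq
      ... | false = z≤n
      ... | true with covers (asked (subst T (sym eq) _))
      ...   | inj₁ a = ℕ.≤-trans (ℕ.≤-reflexive (sym (bit-true a))) (ℕ.m≤n+m _ _)
      ...   | inj₂ b = ℕ.≤-trans (ℕ.≤-reflexive (sym (bit-true b))) (ℕ.m≤m+n _ _)

      rearrange : cost χ ≡ sum (λ i → bit (χ (bd i)) + bit (χ (ask i))) + sum (gadgetCost χ)
      rearrange = trans
        (solve 3 (λ a b c → a :+ (b :+ c) := (a :+ c) :+ b) refl (sum (λ i → bit (χ (bd i)))) (sum (gadgetCost χ)) _)
        (cong (_+ sum (gadgetCost χ)) (sym (∑-distrib-+ (λ i → bit (χ (bd i))) (λ i → bit (χ (ask i))))))
        where open +-*-Solver

      -- Either the cover contains a boundary vertex outside X, which the asking vertices do not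
      -- refund, or gadget x is violated.
      cost-> : ∀ x → T (on x) → mem x ≗ X → budget X < cost χ
      cost-> x o same rewrite rearrange with any? (λ i → T? (χ (bd i)) ×-dec ¬? (T? (X i)))
      ... | yes (i , b , ¬a) = ℕ.+-mono-<-≤
        (sum-mono-< asked-≥ i (ℕ.<-≤-trans (bit-< ¬a b) (ℕ.m≤m+n _ _)))
        (ℕ.≤-trans (ℕ.≤-reflexive (sym (sum-const N base))) (sum-mono-≤ gadget-≥))
      ... | no ¬e = ℕ.+-mono-≤-< (sum-mono-≤ asked-≥)
        (ℕ.≤-<-trans (ℕ.≤-reflexive (sym (sum-const N base)))
          (sum-mono-< gadget-≥ x (gadget-> x o λ i b → subst T (sym (same i))
            (decidable-stable (T? (X i)) λ ¬a → ¬e (i , b , ¬a)))))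

    module _ (on : Fin N → Bool) (X : Fin (suc p * suc p) → Bool)
             (open-column : ∀ x → T (on x) → ∃[ i ] T (X i) × ¬ T (mem x i)) where

      -- An element of `X` outside x names the row and the column to leave uncovered. The default
      -- for a gadget that is off is harmless: its nonzero cells have no edges except those of their
      -- clique.
      choice : Fin N → Fin (suc p) × Fin (suc p)
      choice x with T? (on x)
      ... | yes o = remQuot (suc p) (proj₁ (open-column x o))
      ... | no _  = zero , zero

      choice-open : ∀ x → T (on x) → let r , s = choice x in
                    T (X (combine r s)) × ¬ T (mem x (combine r s))
      choice-open x o with T? (on x)
      ... | no ¬o = contradiction o ¬o
      ... | yes o′ = let i , a , n = open-column x o′
                         e = combine-remQuot {suc p} (suc p) i in
        subst (λ i → T (X i)) (sym e) a , subst (λ i → ¬ T (mem x i)) (sym e) n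

      -- Cell `zero` is the spare vertex of a row clique: in a row that is not chosen the hub vertex
      -- is covered, so leaving out this cell is free and every genuine column stays covered.
      uncoveredCell : Fin N → Fin (suc p) → Fin (suc (suc p))
      uncoveredCell x r with r Fin.≟ proj₁ (choice x)
      ... | yes _ = suc (proj₂ (choice x))
      ... | no _  = zero

      cheap : V → Bool
      cheap (bd i)       = X i
      cheap (hub x r)    = not (does (r Fin.≟ proj₁ (choice x)))
      cheap (cell x r s) = not (does (s Fin.≟ uncoveredCell x r))
      cheap (ask i)      = false

      not-equal : ∀ {n} {i j : Fin n} → i ≢ j → T (not (does (i Fin.≟ j)))
      not-equal {i = i} {j} n rewrite dec-false (i Fin.≟ j) n = _

      one-of-two : ∀ {n} {i j : Fin n} k → i ≢ j → T (not (does (i Fin.≟ k))) ⊎ T (not (does (j Fin.≟ k)))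
      one-of-two {i = i} {j} k n with i Fin.≟ k
      ... | no _     = inj₁ _
      ... | yes refl = inj₂ (not-equal (n ∘ sym))

      cheap-covers : Covers on X cheap
      cheap-covers (hubs n)  = one-of-two _ n
      cheap-covers (cells n) = one-of-two _ n
      cheap-covers (row {x} {r}) with r Fin.≟ proj₁ (choice x)
      ... | yes _ = inj₁ _
      ... | no _  = inj₂ _
      cheap-covers (blocked {x} {r} {s} o m) with r Fin.≟ proj₁ (choice x)
      ... | no _  = inj₂ _
      ... | yes refl = inj₁ (not-equal {i = s} λ { refl → proj₂ (choice-open x o) m })
      cheap-covers (column {x} {r} {s} o ¬m) with r Fin.≟ proj₁ (choice x)
      ... | no _ = inj₁ _
      ... | yes refl with s Fin.≟ proj₂ (choice x)
      ...   | yes refl = inj₂ (proj₁ (choice-open x o))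
      ...   | no n     = inj₁ _
      cheap-covers (asked a) = inj₂ a

      cheap-cost : cost cheap ≡ budget X
      cheap-cost = cong (ℕ._+_ (weight X)) (trans (cong₂ _+_
        (trans (sum-cong-≗ {N} λ x → cong₂ _+_ (all-but-one (proj₁ (choice x)))
          (trans (sum-cong-≗ {suc p} λ r → all-but-one (uncoveredCell x r)) (sum-const (suc p) (suc p))))
          (sum-const N base))
        (trans (sum-const (suc p * suc p) 0) (ℕ.*-zeroʳ (suc p * suc p)))) (ℕ.+-identityʳ _))

  -- Forests: labels, ancestry, and the bags formed by root paths.

  Unique-++⁻ : ∀ (xs : List A) {ys} → Unique (xs ++ ys) → Unique xs × Unique ys × Disjoint xs ys
  Unique-++⁻ []       U       = [] , U , λ ()
  Unique-++⁻ (x ∷ xs) (a ∷ U) =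
    let U₁ , U₂ , D = Unique-++⁻ xs U in
    All.++⁻ˡ xs a ∷ U₁ , U₂ , λ where
      (here refl , m) → All.lookup (All.++⁻ʳ xs a) m refl
      (there l , m)   → D (l , m)

  lookup-injective : ∀ {xs : List A} → Unique xs → ∀ i j → lookup xs i ≡ lookup xs j → i ≡ j
  lookup-injective (a ∷ U) zero    zero    e = refl
  lookup-injective (a ∷ U) zero    (suc j) e = contradiction e (All.lookup a (∈-lookup j))
  lookup-injective (a ∷ U) (suc i) zero    e = contradiction (sym e) (All.lookup a (∈-lookup i))
  lookup-injective (a ∷ U) (suc i) (suc j) e = cong suc (lookup-injective U i j e)

  labels : Forest A → List A
  labels []             = []
  labels (node a g ∷ f) = a ∷ labels g ++ labels f

  -- Ancestry between labels instead of nodes: it is carried along by relabelling and grafting, and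
  -- is translated into `Ancestor` once, at the end.
  data Above {A : Set} : Forest A → A → A → Set where
    root-of : ∀ {u g f v} → v ∈ˡ labels g → Above (node u g ∷ f) u v
    inside  : ∀ {w g f u v} → Above g u v → Above (node w g ∷ f) u v
    beside  : ∀ {t f u v} → Above f u v → Above (t ∷ f) u v

  Above⇒∈ : ∀ {f : Forest A} {u v} → Above f u v → v ∈ˡ labels f
  Above⇒∈ (root-of m) = there (∈-++⁺ˡ m)
  Above⇒∈ (inside a) = there (∈-++⁺ˡ (Above⇒∈ a))
  Above⇒∈ {f = node _ g ∷ f} (beside a) = there (∈-++⁺ʳ (labels g) (Above⇒∈ a))

  beside-node : ∀ {t : Tree A} {f} → Node f → Node (t ∷ f)
  beside-node (here i)    = here (suc i)
  beside-node (below i x) = below (suc i) x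

  label-beside : ∀ {t : Tree A} {f} (x : Node f) → label {f = t ∷ f} (beside-node x) ≡ label x
  label-beside (here i)    = refl
  label-beside (below i x) = refl

  parent-beside : ∀ {t : Tree A} {f} {x y : Node f} → Parent x y →
                  Parent (beside-node {t = t} x) (beside-node y)
  parent-beside (here i j)  = here (suc i) j
  parent-beside (below i p) = below (suc i) p

  label-∈ : ∀ {f : Forest A} (x : Node f) → label x ∈ˡ labels f
  label-∈ {f = node a g ∷ f} (here zero)         = here refl
  label-∈ {f = node a g ∷ f} (here (suc i))      = there (∈-++⁺ʳ (labels g) (label-∈ (here i)))
  label-∈ {f = node a g ∷ f} (below zero x)      = there (∈-++⁺ˡ (label-∈ x))
  label-∈ {f = node a g ∷ f} (below (suc i) x)   = there (∈-++⁺ʳ (labels g) (label-∈ (below i x)))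

  ∈-label : ∀ {f : Forest A} {v} → v ∈ˡ labels f → ∃[ x ] label {f = f} x ≡ v
  ∈-label {f = node a g ∷ f} (here refl) = here zero , refl
  ∈-label {f = node a g ∷ f} (there m) with ∈-++⁻ (labels g) m
  ... | inj₁ l = let x , e = ∈-label {f = g} l in below zero x , e
  ... | inj₂ r = let x , e = ∈-label {f = f} r in beside-node x , trans (label-beside x) e

  label-injective : ∀ {f : Forest A} → Unique (labels f) → (x y : Node f) → label x ≡ label y → x ≡ y
  label-injective {f = []} U (here ())
  label-injective {f = []} U (below () _)
  label-injective {f = node a g ∷ f} (a∉ ∷ U) = compare
    where
    U₁ = proj₁ (Unique-++⁻ (labels g) U)
    U₂ = proj₁ (proj₂ (Unique-++⁻ (labels g) U))
    D  = proj₂ (proj₂ (Unique-++⁻ (labels g) U))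

    ≢g : ∀ (x : Node g) → a ≢ label x
    ≢g x = All.lookup (All.++⁻ˡ (labels g) a∉) (label-∈ x)

    ≢f : ∀ (x : Node f) → a ≢ label x
    ≢f x = All.lookup (All.++⁻ʳ (labels g) a∉) (label-∈ x)

    g≢f : ∀ (x : Node g) (y : Node f) → label x ≢ label y
    g≢f x y e = D (label-∈ x , subst (_∈ˡ labels f) (sym e) (label-∈ y))

    compare : (x y : Node (node a g ∷ f)) → label x ≡ label y → x ≡ y
    compare (here zero)       (here zero)       e = refl
    compare (here zero)       (here (suc j))    e = contradiction e (≢f (here j))
    compare (here zero)       (below zero y)    e = contradiction e (≢g y)
    compare (here zero)       (below (suc j) y) e = contradiction e (≢f (below j y))
    compare (here (suc i))    (here zero)       e = contradiction (sym e) (≢f (here i))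
    compare (below zero x)    (here zero)       e = contradiction (sym e) (≢g x)
    compare (below (suc i) x) (here zero)       e = contradiction (sym e) (≢f (below i x))
    compare (here (suc i))    (here (suc j))    e = cong beside-node (label-injective U₂ (here i) (here j) e)
    compare (here (suc i))    (below (suc j) y) e = cong beside-node (label-injective U₂ (here i) (below j y) e)
    compare (below (suc i) x) (here (suc j))    e = cong beside-node (label-injective U₂ (below i x) (here j) e)
    compare (below (suc i) x) (below (suc j) y) e = cong beside-node (label-injective U₂ (below i x) (below j y) e)
    compare (below zero x)    (below zero y)    e = cong (below zero) (label-injective U₁ x y e)
    compare (here (suc i))    (below zero y)    e = contradiction (sym e) (g≢f y (here i))
    compare (below (suc i) x) (below zero y)    e = contradiction (sym e) (g≢f y (below i x))
    compare (below zero x)    (here (suc j))    e = contradiction e (g≢f x (here j))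
    compare (below zero x)    (below (suc j) y) e = contradiction e (g≢f x (below j y))

  ancestor-map : ∀ {f : Forest A} {g : Forest B} {h : Node f → Node g} →
                 (∀ {x y} → Parent x y → Parent (h x) (h y)) →
                 ∀ {x y} → Ancestor x y → Ancestor (h x) (h y)
  ancestor-map m [ p ]    = [ m p ]
  ancestor-map m (p ∷ ps) = m p ∷ ancestor-map m ps

  root-ancestor : ∀ {f : Forest A} i (y : Node (children (lookup f i))) → Ancestor {f = f} (here i) (below i y)
  root-ancestor i (here j)    = [ here i j ]
  root-ancestor i (below j y) = here i j ∷ ancestor-map (below i) (root-ancestor j y)

  Above⇒Ancestor : ∀ {f : Forest A} {u v} → Above f u v →
                   ∃₂ λ x y → label {f = f} x ≡ u × label y ≡ v × Ancestor x y
  Above⇒Ancestor {f = node u g ∷ f} (root-of m) =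
    let y , e = ∈-label {f = g} m in here zero , below zero y , refl , e , root-ancestor zero y
  Above⇒Ancestor (inside a) =
    let x , y , e , e′ , p = Above⇒Ancestor a in
    below zero x , below zero y , e , e′ , ancestor-map (below zero) p
  Above⇒Ancestor (beside a) =
    let x , y , e , e′ , p = Above⇒Ancestor a in
    beside-node x , beside-node y , trans (label-beside x) e , trans (label-beside y) e′ ,
    ancestor-map parent-beside p

  relabel : (A → B) → Forest A → Forest B
  relabel h []             = []
  relabel h (node a g ∷ f) = node (h a) (relabel h g) ∷ relabel h f

  labels-relabel : ∀ (h : A → B) f → labels (relabel h f) ≡ map h (labels f)
  labels-relabel h []             = refl
  labels-relabel h (node a g ∷ f) = cong (h a ∷_)
    (trans (cong₂ _++_ (labels-relabel h g) (labels-relabel h f)) (sym (map-++ h (labels g) (labels f))))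

  height-relabel : ∀ (h : A → B) f → height (relabel h f) ≡ height f
  height-relabel h []             = refl
  height-relabel h (node a g ∷ f) = cong₂ (λ i j → suc i ⊔ j) (height-relabel h g) (height-relabel h f)

  Above-relabel : ∀ (h : A → B) {f u v} → Above f u v → Above (relabel h f) (h u) (h v)
  Above-relabel h {f = node _ g ∷ f} (root-of m) = root-of (subst (h _ ∈ˡ_) (sym (labels-relabel h g)) (∈-map⁺ h m))
  Above-relabel h {f = node _ g ∷ f} (inside a) = inside (Above-relabel h a)
  Above-relabel h {f = node _ g ∷ f} (beside a) = beside (Above-relabel h a)

  -- The sequence of bags common to all three kinds of decomposition. Sizes, the widths of trees and
  -- paths, and the cut of the encoding are all read off from it.
  pathBags : Subset n → Forest (Fin n) → List (Subset n)
  pathBags P []             = []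
  pathBags P (node v g ∷ f) = pathBags (⁅ v ⁆ ∪ P) g ++ (⁅ v ⁆ ∪ P) ∷ pathBags P f

  length-pathBags : ∀ (P : Subset n) f → length (pathBags P f) ≡ length (labels f)
  length-pathBags P []             = refl
  length-pathBags P (node v g ∷ f) = trans (length-++ (pathBags (⁅ v ⁆ ∪ P) g)) (trans (ℕ.+-suc _ _)
    (cong suc (trans (cong₂ _+_ (length-pathBags _ g) (length-pathBags P f)) (sym (length-++ (labels g))))))

  ∈-insert⁻ : ∀ {v u : Fin n} P → u ∈ ⁅ v ⁆ ∪ P → u ≡ v ⊎ u ∈ P
  ∈-insert⁻ {v = v} P m = Sum.map (x∈⁅y⁆⇒x≡y v) id (x∈p∪q⁻ ⁅ v ⁆ P m)

  ∣insert∣ : ∀ {v : Fin n} {P} → v ∉ P → ∣ ⁅ v ⁆ ∪ P ∣ ≡ suc ∣ P ∣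
  ∣insert∣ {v = zero}  {true ∷ P}  v∉ = contradiction here v∉
  ∣insert∣ {v = zero}  {false ∷ P} v∉ = cong (suc ∘ ∣_∣) (∪-identityˡ P)
  ∣insert∣ {v = suc v} {true ∷ P}  v∉ = cong suc (∣insert∣ (v∉ ∘ there))
  ∣insert∣ {v = suc v} {false ∷ P} v∉ = ∣insert∣ (v∉ ∘ there)

  Fresh : Subset n → Forest (Fin n) → Set
  Fresh P f = Unique (labels f) × (∀ {u} → u ∈ˡ labels f → u ∉ P)

  fresh-children : ∀ {P : Subset n} {v g f} → Fresh P (node v g ∷ f) → Fresh (⁅ v ⁆ ∪ P) g
  fresh-children {P = P} {g = g} (v≢ ∷ U , P#) = proj₁ (Unique-++⁻ (labels g) U) , λ m m′ →
    [ (λ e → All.lookup v≢ (∈-++⁺ˡ m) (sym e)) , P# (there (∈-++⁺ˡ m)) ]′ (∈-insert⁻ P m′)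

  fresh-rest : ∀ {P : Subset n} {v g f} → Fresh P (node v g ∷ f) → Fresh P f
  fresh-rest {g = g} (_ ∷ U , P#) =
    proj₁ (proj₂ (Unique-++⁻ (labels g) U)) , λ m → P# (there (∈-++⁺ʳ (labels g) m))

  pathBags-≤ : ∀ {P : Subset n} f → Fresh P f → All (λ X → ∣ X ∣ ≤ ∣ P ∣ + height f) (pathBags P f)
  pathBags-≤ []             F = []
  pathBags-≤ {P = P} (node v g ∷ f) F = All.++⁺
    (All.map (λ {X} l → ℕ.≤-trans l (ℕ.≤-trans (ℕ.≤-reflexive deeper)
        (ℕ.+-monoʳ-≤ ∣ P ∣ (ℕ.m≤m⊔n (suc (height g)) (height f)))))
      (pathBags-≤ g (fresh-children F)))
    (ℕ.≤-trans (ℕ.≤-reflexive (∣insert∣ (proj₂ F (here refl))))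
        (ℕ.≤-trans (ℕ.≤-reflexive (ℕ.+-comm 1 ∣ P ∣))
          (ℕ.+-monoʳ-≤ ∣ P ∣ (ℕ.≤-trans (s≤s z≤n) (ℕ.m≤m⊔n (suc (height g)) (height f)))))
     ∷ All.map (λ l → ℕ.≤-trans l (ℕ.+-monoʳ-≤ ∣ P ∣ (ℕ.m≤n⊔m (suc (height g)) (height f))))
      (pathBags-≤ f (fresh-rest F)))
    where
    deeper : ∣ ⁅ v ⁆ ∪ P ∣ + height g ≡ ∣ P ∣ + suc (height g)
    deeper = trans (cong (_+ height g) (∣insert∣ (proj₂ F (here refl)))) (sym (ℕ.+-suc ∣ P ∣ (height g)))

  -- The bag at the end of a longest root path attains the upper bound. Height zero is set apart
  -- because it has no bag to exhibit; there the default value of `max` takes over.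
  pathBags-≥ : ∀ {P : Subset n} f → Fresh P f → height f ≡ 0 ⊎ Any (λ X → ∣ P ∣ + height f ≤ ∣ X ∣) (pathBags P f)
  pathBags-≥ []             F = inj₁ refl
  pathBags-≥ {P = P} (node v g ∷ f) F with ℕ.⊔-sel (suc (height g)) (height f)
  ... | inj₁ e rewrite e with pathBags-≥ g (fresh-children F)
  ...   | inj₁ z = inj₂ (Any.++⁺ʳ (pathBags (⁅ v ⁆ ∪ P) g) (here (ℕ.≤-reflexive
    (trans (cong (λ h → ∣ P ∣ + suc h) z) (trans (ℕ.+-comm ∣ P ∣ 1) (sym (∣insert∣ (proj₂ F (here refl)))))))))
  ...   | inj₂ a = inj₂ (Any.++⁺ˡ (Any.map (λ l → ℕ.≤-trans (ℕ.≤-reflexive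
    (trans (ℕ.+-suc ∣ P ∣ (height g)) (cong (_+ height g) (sym (∣insert∣ (proj₂ F (here refl))))))) l) a))
  pathBags-≥ {P = P} (node v g ∷ f) F | inj₂ e rewrite e with pathBags-≥ f (fresh-rest F)
  ... | inj₁ z = inj₁ z
  ... | inj₂ a = inj₂ (Any.++⁺ʳ (pathBags (⁅ v ⁆ ∪ P) g) (there a))

  max-pathBags : ∀ (f : Forest (Fin n)) → Fresh ∅ f → max 0 (map ∣_∣ (pathBags ∅ f)) ≡ height f
  max-pathBags {n} f F = ℕ.≤-antisym
    (max≤v⁺ z≤n (All.map⁺ (All.map (λ l → ℕ.≤-trans l (ℕ.≤-reflexive (cong (_+ height f) (∣⊥∣≡0 n)))) (pathBags-≤ f F))))
    (v≤max⁺ _ _ (Sum.map (λ e → ℕ.≤-reflexive e)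
      (Any.map⁺ ∘ Any.map (λ l → ℕ.≤-trans (ℕ.≤-reflexive (cong (_+ height f) (sym (∣⊥∣≡0 n)))) l)) (pathBags-≥ f F)))

  postorder-rootPaths : ∀ (P : Subset n) f → map Separator.bag (postorder P (rootPaths P f)) ≡ pathBags P f
  postorder-rootPaths P []             = refl
  postorder-rootPaths P (node v g ∷ f) =
    trans (map-++ _ (postorder (⁅ v ⁆ ∪ P) (rootPaths (⁅ v ⁆ ∪ P) g)) _)
      (cong₂ _++_ (postorder-rootPaths _ g) (cong (_ ∷_) (postorder-rootPaths P f)))

  -- This makes the edges listed at a separator a star around `v`, which is where compactness comes
  -- from.
  Peeled : Separator n → Set
  Peeled s = ∃[ v ] ∀ {u} → u ∈ Separator.bag s → u ≡ v ⊎ u ∈ Separator.above s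

  peeled-rootPaths : ∀ (P : Subset n) f → All Peeled (postorder P (rootPaths P f))
  peeled-rootPaths P []             = []
  peeled-rootPaths P (node v g ∷ f) =
    All.++⁺ (peeled-rootPaths _ g) ((v , ∈-insert⁻ P) ∷ peeled-rootPaths P f)

  -- From an elimination forest to a path decomposition.

  -- Reversed postorder: the vertex listed with a bag is eliminated there, towards the root.
  eliminations : Subset n → Forest (Fin n) → List (Fin n × Subset n)
  eliminations P []             = []
  eliminations P (node v g ∷ f) =
    eliminations P f ++ (v , ⁅ v ⁆ ∪ P) ∷ eliminations (⁅ v ⁆ ∪ P) g

  eliminations-bags : ∀ (P : Subset n) f → reverse (map proj₂ (eliminations P f)) ≡ pathBags P f
  eliminations-bags P []             = refl
  eliminations-bags P (node v g ∷ f)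
    rewrite map-++ proj₂ (eliminations P f) ((v , ⁅ v ⁆ ∪ P) ∷ eliminations (⁅ v ⁆ ∪ P) g)
          | reverse-++ (map proj₂ (eliminations P f)) ((⁅ v ⁆ ∪ P) ∷ map proj₂ (eliminations (⁅ v ⁆ ∪ P) g))
          | unfold-reverse (⁅ v ⁆ ∪ P) (map proj₂ (eliminations (⁅ v ⁆ ∪ P) g))
          | eliminations-bags P f | eliminations-bags (⁅ v ⁆ ∪ P) g
    = ++-assoc (pathBags (⁅ v ⁆ ∪ P) g) _ _

  ∈-eliminations⁻ : ∀ (P : Subset n) f {v X} → (v , X) ∈ˡ eliminations P f →
                    v ∈ˡ labels f × v ∈ X × (∀ {u} → u ∈ X → u ∈ P ⊎ u ∈ˡ labels f)
  ∈-eliminations⁻ P (node w g ∷ f) m with ∈-++⁻ (eliminations P f) m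
  ... | inj₁ m₁ = let l , i , h = ∈-eliminations⁻ P f m₁ in
    there (∈-++⁺ʳ (labels g) l) , i , Sum.map₂ (there ∘ ∈-++⁺ʳ (labels g)) ∘ h
  ... | inj₂ (here refl) = here refl , p⊆p∪q P (x∈⁅x⁆ w) ,
    λ i → [ inj₂ ∘ here , inj₁ ]′ (∈-insert⁻ P i)
  ... | inj₂ (there m₂) = let l , i , h = ∈-eliminations⁻ (⁅ w ⁆ ∪ P) g m₂ in
    there (∈-++⁺ˡ l) , i ,
    λ j → [ [ inj₂ ∘ here , inj₁ ]′ ∘ ∈-insert⁻ P , inj₂ ∘ there ∘ ∈-++⁺ˡ ]′ (h j)

  ∈-eliminations⁺ : ∀ (P : Subset n) f {v} → v ∈ˡ labels f →
                    ∃[ X ] (v , X) ∈ˡ eliminations P f × P ⊆ X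
  ∈-eliminations⁺ P (node w g ∷ f) (here refl) =
    _ , ∈-++⁺ʳ (eliminations P f) (here refl) , q⊆p∪q ⁅ w ⁆ P
  ∈-eliminations⁺ P (node w g ∷ f) (there m) with ∈-++⁻ (labels g) m
  ... | inj₁ l = let X , i , s = ∈-eliminations⁺ (⁅ w ⁆ ∪ P) g l in
    X , ∈-++⁺ʳ (eliminations P f) (there i) , s ∘ q⊆p∪q ⁅ w ⁆ P
  ... | inj₂ r = let X , i , s = ∈-eliminations⁺ P f r in X , ∈-++⁺ˡ i , s

  above-eliminations : ∀ (P : Subset n) f {u v} → Above f u v →
                       ∃[ X ] (v , X) ∈ˡ eliminations P f × u ∈ X
  above-eliminations P (node w g ∷ f) (root-of m) =
    let X , i , s = ∈-eliminations⁺ (⁅ w ⁆ ∪ P) g m in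
    X , ∈-++⁺ʳ (eliminations P f) (there i) , s (p⊆p∪q P (x∈⁅x⁆ w))
  above-eliminations P (node w g ∷ f) (inside a) =
    let X , i , s = above-eliminations (⁅ w ⁆ ∪ P) g a in X , ∈-++⁺ʳ (eliminations P f) (there i) , s
  above-eliminations P (node w g ∷ f) (beside a) =
    let X , i , s = above-eliminations P f a in X , ∈-++⁺ˡ i , s

  -- For all pairs of a list that runs from the root downwards: the bag paired with a vertex is its
  -- topmost occurrence.
  Later : (e e′ : Fin n × Subset n) → Set
  Later (v , X) (v′ , X′) = v′ ∉ X

  eliminations-later : ∀ {P : Subset n} f → Fresh P f → AllPairs Later (eliminations P f)
  eliminations-later []             F = []
  eliminations-later {P = P} (node v g ∷ f) F@(v≢ ∷ U , P#) =
    AllPairs.++⁺ (eliminations-later f (fresh-rest F))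
      (All.tabulate (λ {e} m m′ → proj₂ (fresh-children F) (proj₁ (∈-eliminations⁻ _ g m)) m′)
        ∷ eliminations-later g (fresh-children F))
      (All.tabulate λ {e} m → All.tabulate λ {e′} m′ i →
        let l = proj₂ (proj₂ (∈-eliminations⁻ P f m)) i in
        [ P# (split m′) , separate m′ ]′ l)
    where
    split : ∀ {w X} → (w , X) ∈ˡ (v , ⁅ v ⁆ ∪ P) ∷ eliminations (⁅ v ⁆ ∪ P) g → w ∈ˡ v ∷ labels g ++ labels f
    split (here refl) = here refl
    split (there m)   = there (∈-++⁺ˡ (proj₁ (∈-eliminations⁻ _ g m)))

    separate : ∀ {w X} → (w , X) ∈ˡ (v , ⁅ v ⁆ ∪ P) ∷ eliminations (⁅ v ⁆ ∪ P) g → w ∉ˡ labels f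
    separate (here refl) l = All.lookup v≢ (∈-++⁺ʳ (labels g) l) refl
    separate (there m)   l = proj₂ (proj₂ (Unique-++⁻ (labels g) U)) (proj₁ (∈-eliminations⁻ _ g m) , l)

  Chain : Subset n → List (Fin n × Subset n) → Set
  Chain X []              = ⊤
  Chain X ((v , Y) ∷ es) = (∀ {u} → u ∈ Y → u ≡ v ⊎ u ∈ X) × Chain Y es

  -- Laying sibling subtrees one after another keeps the chain condition, since every bag of a
  -- subtree contains `P` and the next root adds a single vertex to `P`. That inclusion is all that
  -- is known of the last bag, so the continuation `es` must accept any `Y` above `P`.
  eliminations-chain : ∀ (P : Subset n) f {X es} → P ⊆ X → (∀ {Y} → P ⊆ Y → Chain Y es) →
                       Chain X (eliminations P f ++ es)
  eliminations-chain P []             s k = k s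
  eliminations-chain P (node v g ∷ f) {X} {es} s k
    rewrite ++-assoc (eliminations P f) ((v , ⁅ v ⁆ ∪ P) ∷ eliminations (⁅ v ⁆ ∪ P) g) es =
    eliminations-chain P f s λ s′ →
      (λ i → Sum.map₂ s′ (∈-insert⁻ P i)) ,
      eliminations-chain (⁅ v ⁆ ∪ P) g id (λ s″ → k (s″ ∘ q⊆p∪q ⁅ v ⁆ P))

  pathTree : {A : Set} → A → List A → Tree A
  pathTree a []       = node a []
  pathTree a (b ∷ bs) = node a (pathTree b bs ∷ [])

  pathTree-isPath : {A : Set} (a : A) (bs : List A) → IsPath (pathTree a bs)
  pathTree-isPath a []       = end
  pathTree-isPath a (b ∷ bs) = step (pathTree-isPath b bs)

  ∈-pathTree : {A : Set} (a : A) (bs : List A) {c : A} → c ∈ˡ a ∷ bs → ∃[ x ] label {f = pathTree a bs ∷ []} x ≡ c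
  ∈-pathTree a []       (here refl) = here zero , refl
  ∈-pathTree a (b ∷ bs) (here refl) = here zero , refl
  ∈-pathTree a (b ∷ bs) (there m)   = let x , e = ∈-pathTree b bs m in below zero x , e

  postorder-pathTree : ∀ (P X : Subset n) Xs →
                       map Separator.bag (postorder P (pathTree X Xs ∷ [])) ≡ reverse (X ∷ Xs)
  postorder-pathTree P X []       = refl
  postorder-pathTree P X (Y ∷ Xs) = trans (map-++ _ (postorder X (pathTree Y Xs ∷ [])) _)
    (trans (cong (_++ X ∷ []) (postorder-pathTree X Y Xs)) (sym (unfold-reverse X (Y ∷ Xs))))

  peeled-pathTree : ∀ (P : Subset n) {v X es} → Chain P ((v , X) ∷ es) →
                    All Peeled (postorder P (pathTree X (map proj₂ es) ∷ []))
  peeled-pathTree P {v} {es = []}          (h , _) = (v , h) ∷ []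
  peeled-pathTree P {v} {X} {es = _ ∷ es} (h , c) = All.++⁺ (peeled-pathTree X {es = es} c) ((v , h) ∷ [])

  module _ {n : ℕ} (u : Fin n) where

    private
      Linked : ∀ {f : Forest (Subset n)} → Node f → Node f → Set
      Linked x y = Parent x y × u ∈ label x × u ∈ label y

      below-linked : ∀ {X T} {x y : Node (T ∷ [])} → EqClosure Linked x y →
                     EqClosure (Linked {node X (T ∷ []) ∷ []}) (below zero x) (below zero y)
      below-linked = Eq.gmap (below zero) λ (p , i , j) → below zero p , i , j

    -- Occurrences of u climb towards the root until the bag where u is eliminated.
    linked-to-root : ∀ {X} es → Chain X es → u ∉ˡ map proj₁ es →
                     (x : Node (pathTree X (map proj₂ es) ∷ [])) → u ∈ label x →
                     EqClosure Linked x (here zero) × u ∈ X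
    linked-to-root []             c u∉ (here zero)       i = Star.ε , i
    linked-to-root []             c u∉ (below zero (here ())) i
    linked-to-root []             c u∉ (below zero (below () _)) i
    linked-to-root ((w , Y) ∷ es) c u∉ (here zero)       i = Star.ε , i
    linked-to-root ((w , Y) ∷ es) (h , c) u∉ (below zero x) i =
      let p , j = linked-to-root es c (u∉ ∘ there) x i
          k = [ (λ e → contradiction (here e) u∉) , id ]′ (h j) in
      Eq.transitive Linked (below-linked p) (bwd (here zero zero , k , root-label w Y es j) ◅ Star.ε) , k
      where
      root-label : ∀ (w : Fin n) Y es → u ∈ Y → u ∈ label {f = pathTree Y (map proj₂ es) ∷ []} (here zero)
      root-label w Y []      j = j
      root-label w Y (_ ∷ _) j = j

    -- If `u` is in the top bag, it is eliminated nowhere below, so both occurrences climb to the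
    -- root and meet there. If not, the top bag is dropped and the argument repeated.
    all-linked : ∀ {v X} es → AllPairs Later ((v , X) ∷ es) → Chain X es →
                 (x y : Node (pathTree X (map proj₂ es) ∷ [])) →
                 u ∈ label x → u ∈ label y → EqClosure Linked x y
    all-linked {X = X} es (l ∷ ls) c x y i j with u ∈? X
    ... | yes u∈ = Eq.transitive Linked (proj₁ (linked-to-root es c u∉ x i))
                     (Eq.symmetric Linked (proj₁ (linked-to-root es c u∉ y j)))
      where
      u∉ : u ∉ˡ map proj₁ es
      u∉ m with (_ , m′ , refl) ← ∈-map⁻ proj₁ m = All.lookup l m′ u∈
    all-linked []       _        _       (here zero) _            i _ | no u∉ = contradiction i u∉
    all-linked []       _        _       (below zero (here ())) _    _ _ | no u∉
    all-linked []       _        _       (below zero (below () _)) _ _ _ | no u∉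
    all-linked (_ ∷ es) _        _       (here zero) _            i _ | no u∉ = contradiction i u∉
    all-linked (_ ∷ es) _        _       (below zero _) (here zero) _ j | no u∉ = contradiction j u∉
    all-linked (_ ∷ es) (_ ∷ ls) (_ , c) (below zero x) (below zero y) i j | no u∉ =
      below-linked (all-linked es ls c x y i j)

  module _ (G : Graph) (v : Graph.Vertex G) (g : Forest (Graph.Vertex G))
           (fresh : Fresh ∅ (node v g ∷ []))
           (complete : ∀ u → u ∈ˡ labels (node v g ∷ []))
           (vertical : ∀ u w → Graph.Adj G u w →
                       Above (node v g ∷ []) u w ⊎ Above (node v g ∷ []) w u) where

    private
      es = eliminations (⁅ v ⁆ ∪ ∅) g

      es-chain : Chain ∅ ((v , ⁅ v ⁆ ∪ ∅) ∷ es)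
      es-chain = subst (Chain ∅) (++-identityʳ _) (eliminations-chain ∅ (node v g ∷ []) {es = []} id _)

      occurrence : ∀ {w X} → (w , X) ∈ˡ (v , ⁅ v ⁆ ∪ ∅) ∷ es →
                   ∃[ x ] label {f = pathTree (⁅ v ⁆ ∪ ∅) (map proj₂ es) ∷ []} x ≡ X
      occurrence m = ∈-pathTree _ _ (∈-map⁺ proj₂ m)

      own : ∀ {w X} → (w , X) ∈ˡ (v , ⁅ v ⁆ ∪ ∅) ∷ es → w ∈ X
      own m = proj₁ (proj₂ (∈-eliminations⁻ ∅ (node v g ∷ []) m))

      together : ∀ {u w} → Above (node v g ∷ []) u w →
                 ∃[ x ] u ∈ label {f = pathTree (⁅ v ⁆ ∪ ∅) (map proj₂ es) ∷ []} x × w ∈ label x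
      together a with X , m , i ← above-eliminations ∅ (node v g ∷ []) a
                 with x , refl ← occurrence m = x , i , own m

    pathDecomposition : PathDecomposition G
    pathDecomposition = record
      { treeDecomposition = record
        { tree            = pathTree (⁅ v ⁆ ∪ ∅) (map proj₂ es)
        ; covers-vertices = λ u →
            let X , m , _ = ∈-eliminations⁺ ∅ (node v g ∷ []) (complete u)
                x , e = occurrence m in
            x , subst (u ∈_) (sym e) (own m)
        ; covers-edges    = λ u w a → [ together , (λ b → let x , i , j = together b in x , j , i) ]′ (vertical u w a)
        ; connected       = λ u → all-linked u es (eliminations-later (node v g ∷ []) fresh) (proj₂ es-chain)
        }
      ; isPath = pathTree-isPath _ _
      }

    bags-pathDecomposition : map Separator.bag (separators path pathDecomposition) ≡ pathBags ∅ (node v g ∷ [])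
    bags-pathDecomposition = trans (postorder-pathTree ∅ (⁅ v ⁆ ∪ ∅) (map proj₂ es))
      (eliminations-bags ∅ (node v g ∷ []))

    peeled-pathDecomposition : All Peeled (separators path pathDecomposition)
    peeled-pathDecomposition = peeled-pathTree ∅ es-chain

    treedepthDecomposition : TreedepthDecomposition G
    treedepthDecomposition = record
      { forest          = node v g ∷ []
      ; label-bijective = (λ {x} {y} → label-injective (proj₁ fresh) x y) ,
                          λ u → let x , e = ∈-label (complete u) in x , λ { refl → e }
      ; edges-vertical  = λ x y a → Sum.map (ancestor x y) (ancestor y x) (vertical (label x) (label y) a)
      }
      where
      ancestor : (x y : Node (node v g ∷ [])) → Above (node v g ∷ []) (label x) (label y) → Ancestor x y
      ancestor x y a with x′ , y′ , e , e′ , p ← Above⇒Ancestor a =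
        subst₂ Ancestor (label-injective (proj₁ fresh) x′ x e) (label-injective (proj₁ fresh) y′ y e′) p

  -- The encoding of one separator: compactness and locality.

  length-filter-suc : ∀ b (X : Subset n) is →
                      length (filter (_∈? (b ∷ X)) (map suc is)) ≡ length (filter (_∈? X) is)
  length-filter-suc b X []       = refl
  length-filter-suc b X (i ∷ is) with does (i ∈? X)
  ... | true  = cong suc (length-filter-suc b X is)
  ... | false = length-filter-suc b X is

  length-members : (X : Subset n) → length (members X) ≡ ∣ X ∣
  length-members []      = refl
  length-members {n = suc n} (b ∷ X)
    with e ← trans (cong (length ∘ filter (_∈? (b ∷ X))) (sym (map-tabulate {n = n} id suc)))
               (trans (length-filter-suc b X (allFin n)) (length-members X))
    with b
  ... | true  = cong suc e
  ... | false = e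

  -- The other ends of the edges at p in a simple graph are distinct.
  star-≤ : ∀ {m} (p : Fin m) (es : List (Fin m × Fin m)) → Unique es →
           (∀ {i j} → (i , j) ∈ˡ es → i Fin.< j × (i ≡ p ⊎ j ≡ p)) → length es ≤ m ∸ 1
  star-≤ {suc m} p es U at-p = Fin.injective⇒≤ {f = λ k → punchOut (other≢ (∈-lookup k))} λ {k} {l} e →
    lookup-injective U k l (other-injective (∈-lookup k) (∈-lookup l)
      (Fin.punchOut-injective (other≢ (∈-lookup k)) (other≢ (∈-lookup l)) e))
    where
    other : Fin (suc m) × Fin (suc m) → Fin (suc m)
    other (i , j) with i Fin.≟ p
    ... | yes _ = j
    ... | no _  = i

    other≢ : ∀ {e} → e ∈ˡ es → p ≢ other e
    other≢ {i , j} e with i Fin.≟ p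
    ... | yes refl = λ { refl → ℕ.<-irrefl refl (proj₁ (at-p e)) }
    ... | no i≢p   = i≢p ∘ sym

    other-injective : ∀ {e e′} → e ∈ˡ es → e′ ∈ˡ es → other e ≡ other e′ → e ≡ e′
    other-injective {i , j} {k , l} e e′ q with i Fin.≟ p | k Fin.≟ p | at-p e | at-p e′
    ... | yes refl | yes refl | _          | _               = cong (p ,_) q
    ... | yes refl | no k≢p   | i<j , _    | k<l , inj₁ k≡p  = contradiction k≡p k≢p
    ... | yes refl | no k≢p   | i<j , _    | k<l , inj₂ refl = contradiction (subst (p Fin.<_) q i<j) (ℕ.<-asym k<l)
    ... | no i≢p   | yes refl | i<j , inj₁ i≡p  | k<l , _    = contradiction i≡p i≢p
    ... | no i≢p   | yes refl | i<j , inj₂ refl | k<l , _    = contradiction (subst (p Fin.<_) (sym q) k<l) (ℕ.<-asym i<j)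
    ... | no i≢p   | no k≢p   | _ , inj₁ i≡p    | _          = contradiction i≡p i≢p
    ... | no i≢p   | no k≢p   | _ , inj₂ j≡p    | _ , inj₁ k≡p = contradiction k≡p k≢p
    ... | no i≢p   | no k≢p   | _ , inj₂ refl   | _ , inj₂ refl = cong (_, p) q

  module _ (G : Graph) (s : Separator (Graph.order G)) where

    private
      m = length (members (Separator.bag s))

      member : Fin m → Graph.Vertex G
      member = lookup (members (Separator.bag s))

    member-injective : ∀ i j → member i ≡ member j → i ≡ j
    member-injective = lookup-injective (Unique.filter⁺ (_∈? Separator.bag s) (Unique.allFin⁺ _))

    member-∈ : ∀ i → member i ∈ Separator.bag s
    member-∈ i = proj₂ (∈-filter⁻ (_∈? Separator.bag s) {xs = allFin _} (∈-lookup i))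

    listed : ∀ {i j} → (i , j) ∈ˡ listedEdges G s →
             i Fin.< j × ¬ (member i ∈ Separator.above s × member j ∈ Separator.above s)
    listed e = let l , _ , o = proj₂ (∈-filter⁻ _ {xs = cartesianProduct (allFin _) (allFin _)} e) in l , o

    listed-unique : Unique (listedEdges G s)
    listed-unique = Unique.filter⁺ _ (Unique.cartesianProduct⁺ (Unique.allFin⁺ _) (Unique.allFin⁺ _))

    -- A listed edge has an end outside the parent's bag, and only `v` can be that end. So the
    -- listed edges form a star on at most all vertices of the bag.
    length-listed : Peeled s → length (listedEdges G s) ≤ ∣ Separator.bag s ∣ ∸ 1
    length-listed (v , peeled) = subst (λ m → length (listedEdges G s) ≤ m ∸ 1) (length-members (Separator.bag s))
      (bound (listedEdges G s) refl)
      where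
      at-v : ∀ {i j} → (i , j) ∈ˡ listedEdges G s → member i ≡ v ⊎ member j ≡ v
      at-v {i} {j} e with peeled (member-∈ i) | peeled (member-∈ j)
      ... | inj₁ p | _      = inj₁ p
      ... | inj₂ _ | inj₁ q = inj₂ q
      ... | inj₂ a | inj₂ b = contradiction (a , b) (proj₂ (listed e))

      star : ∀ p → member p ≡ v → length (listedEdges G s) ≤ m ∸ 1
      star p refl = star-≤ p (listedEdges G s) listed-unique λ e →
        proj₁ (listed e) , Sum.map (member-injective _ _) (member-injective _ _) (at-v e)

      bound : ∀ es → es ≡ listedEdges G s → length (listedEdges G s) ≤ m ∸ 1
      -- `v` need not lie in the bag; its position is read off from a listed edge, if there is one.
      bound []            e rewrite sym e = z≤n
      bound ((i , j) ∷ _) e = [ star i , star j ]′ (at-v (subst ((i , j) ∈ˡ_) e (here refl)))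

  -- The encoding consults adjacency only between members of the bag. Both graphs are spelled out as
  -- records so that their orders are literally the same `n` and one separator serves both.
  encodeSeparator-local :
    ∀ {n} {A A′ : Fin n → Fin n → Bool} {y y′ l l′} (s : Separator n) →
    (∀ {u w} → u ∈ Separator.bag s → w ∈ Separator.bag s → A u w ≡ A′ u w) →
    encodeSeparator (record { order = n ; adjacent = A ; symmetric = y ; loopless = l }) s ≡
    encodeSeparator (record { order = n ; adjacent = A′ ; symmetric = y′ ; loopless = l′ }) s
  encodeSeparator-local {n} {A} {A′} {y} {y′} {l} {l′} s same =
    cong (λ es → numeral (Separator.arity s) ++ colon ∷ List.concatMap item (members (Separator.bag s)) ++ bar ∷
                 List.concatMap (λ (i , j) → item i ++ item j) es ++ hash ∷ [])
      (filter-≐ (listed? A) (listed? A′)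
        ((λ (a , b , c) → a , subst T (adj _ _) b , c) , λ (a , b , c) → a , subst T (sym (adj _ _)) b , c)
        (cartesianProduct (allFin _) (allFin _)))
    where
    G : Graph
    G = record { order = n ; adjacent = A ; symmetric = y ; loopless = l }

    member : Fin (length (members (Separator.bag s))) → Fin n
    member = lookup (members (Separator.bag s))

    listed? = λ (A : Fin n → Fin n → Bool) (i , j) →
      (i Fin.<? j) ×-dec T? (A (member i) (member j)) ×-dec
      ¬? ((member i ∈? Separator.above s) ×-dec (member j ∈? Separator.above s))

    adj : ∀ i j → A (member i) (member j) ≡ A′ (member i) (member j)
    adj i j = same (member-∈ G s i) (member-∈ G s j)

  isYes-⇔ : {P Q : Set} → (P → Q) → (Q → P) → (p? : Dec P) (q? : Dec Q) → ⌊ p? ⌋ ≡ ⌊ q? ⌋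
  isYes-⇔ f g (yes p) (yes q) = refl
  isYes-⇔ f g (yes p) (no ¬q) = contradiction (f p) ¬q
  isYes-⇔ f g (no ¬p) (yes q) = contradiction (g q) ¬p
  isYes-⇔ f g (no ¬p) (no ¬q) = refl

  isYes-false : {P : Set} → ¬ P → (p? : Dec P) → ⌊ p? ⌋ ≡ false
  isYes-false ¬p (yes p) = contradiction p ¬p
  isYes-false ¬p (no _)  = refl

  -- Assembling forests from chains and concatenations.

  chain : List A → Forest A → Forest A
  chain []       g = g
  chain (a ∷ as) g = node a (chain as g) ∷ []

  labels-chain : ∀ (as : List A) g → labels (chain as g) ≡ as ++ labels g
  labels-chain []       g = refl
  labels-chain (a ∷ as) g = cong (a ∷_) (trans (++-identityʳ _) (labels-chain as g))

  labels-++ : ∀ (f g : Forest A) → labels (f ++ g) ≡ labels f ++ labels g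
  labels-++ []             g = refl
  labels-++ (node a h ∷ f) g = cong (a ∷_)
    (trans (cong (labels h ++_) (labels-++ f g)) (sym (++-assoc (labels h) (labels f) (labels g))))

  labels-concatMap : ∀ (F : B → Forest A) xs → labels (concatMap F xs) ≡ concatMap (labels ∘ F) xs
  labels-concatMap F []       = refl
  labels-concatMap F (x ∷ xs) = trans (labels-++ (F x) (concatMap F xs)) (cong (labels (F x) ++_) (labels-concatMap F xs))

  height-chain : ∀ (as : List A) g → height (chain as g) ≡ length as + height g
  height-chain []       g = refl
  height-chain (a ∷ as) g = cong suc (height-chain as g)

  height-++ : ∀ (f g : Forest A) → height (f ++ g) ≡ height f ⊔ height g
  height-++ []             g = refl
  height-++ (node a h ∷ f) g = trans (cong (suc (height h) ⊔_) (height-++ f g)) (sym (ℕ.⊔-assoc (suc (height h)) (height f) (height g)))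

  height-concatMap : ∀ (F : B → Forest A) {h x xs} → (∀ x → height (F x) ≡ h) → x ∈ˡ xs →
                     height (concatMap F xs) ≡ h
  height-concatMap F {xs = x ∷ []}     e _ = trans (cong height (++-identityʳ (F x))) (e x)
  height-concatMap F {xs = x ∷ y ∷ ys} e _ = trans (height-++ (F x) (concatMap F (y ∷ ys)))
    (trans (cong₂ _⊔_ (e x) (height-concatMap F {x = y} {xs = y ∷ ys} e (here refl))) (ℕ.⊔-idem _))

  relabel-chain : ∀ (h : A → B) as g → relabel h (chain as g) ≡ chain (map h as) (relabel h g)
  relabel-chain h []       g = refl
  relabel-chain h (a ∷ as) g = cong (λ f → node (h a) f ∷ []) (relabel-chain h as g)

  relabel-++ : ∀ (h : A → B) f g → relabel h (f ++ g) ≡ relabel h f ++ relabel h g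
  relabel-++ h []             g = refl
  relabel-++ h (node a k ∷ f) g = cong (_ ∷_) (relabel-++ h f g)

  above-++ˡ : ∀ {f g : Forest A} {u v} → Above f u v → Above (f ++ g) u v
  above-++ˡ (root-of m) = root-of m
  above-++ˡ (inside a)  = inside a
  above-++ˡ (beside a)  = beside (above-++ˡ a)

  above-++ʳ : ∀ (f : Forest A) {g u v} → Above g u v → Above (f ++ g) u v
  above-++ʳ []      a = a
  above-++ʳ (t ∷ f) a = beside (above-++ʳ f a)

  above-concatMap : ∀ (F : B → Forest A) {x xs u v} → x ∈ˡ xs → Above (F x) u v → Above (concatMap F xs) u v
  above-concatMap F         (here refl) a = above-++ˡ a
  above-concatMap F {xs = y ∷ _} (there m) a = above-++ʳ (F y) (above-concatMap F m a)

  above-chain : ∀ (as : List A) {g u v} → Above g u v → Above (chain as g) u v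
  above-chain []       a = a
  above-chain (b ∷ as) a = inside (above-chain as a)

  above-chain-end : ∀ {as : List A} {g u v} → u ∈ˡ as → v ∈ˡ labels g → Above (chain as g) u v
  above-chain-end {as = a ∷ as} {g} (here refl) m =
    root-of (subst (_ ∈ˡ_) (sym (labels-chain as g)) (∈-++⁺ʳ as m))
  above-chain-end {as = a ∷ as} (there i) m = inside (above-chain-end i m)

  above-chain-within : ∀ {as : List A} {g u v} → u ∈ˡ as → v ∈ˡ as → u ≢ v →
                       Above (chain as g) u v ⊎ Above (chain as g) v u
  above-chain-within (here refl) (here refl) n = contradiction refl n
  above-chain-within {as = _ ∷ as} {g} (here refl) (there j) n =
    inj₁ (root-of (subst (_ ∈ˡ_) (sym (labels-chain as g)) (∈-++⁺ˡ j)))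
  above-chain-within {as = _ ∷ as} {g} (there i) (here refl) n =
    inj₂ (root-of (subst (_ ∈ˡ_) (sym (labels-chain as g)) (∈-++⁺ˡ i)))
  above-chain-within (there i) (there j) n = Sum.map inside inside (above-chain-within i j n)

  pathBags-++ : ∀ (P : Subset n) f g → pathBags P (f ++ g) ≡ pathBags P f ++ pathBags P g
  pathBags-++ P []             g = refl
  pathBags-++ P (node v h ∷ f) g = trans (cong (λ bs → pathBags (⁅ v ⁆ ∪ P) h ++ _ ∷ bs) (pathBags-++ P f g))
    (sym (++-assoc (pathBags (⁅ v ⁆ ∪ P) h) _ _))

  Within : (Fin n → Set) → Subset n → Set
  Within R X = ∀ {u} → u ∈ X → R u

  within-insert : ∀ {R : Fin n → Set} {v P} → R v → Within R P → Within R (⁅ v ⁆ ∪ P)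
  within-insert {R = R} {P = P} r w i = [ (λ e → subst R (sym e) r) , w ]′ (∈-insert⁻ P i)

  pathBags-within : ∀ {R : Fin n → Set} {P} f → Within R P → All R (labels f) → All (Within R) (pathBags P f)
  pathBags-within []             w _        = []
  pathBags-within (node v g ∷ f) w (r ∷ rs) = All.++⁺
    (pathBags-within g (within-insert r w) (All.++⁻ˡ (labels g) rs))
    (within-insert r w ∷ pathBags-within f w (All.++⁻ʳ (labels g) rs))

  -- In postorder a chain comes after everything hung below it, so its own bags `Xs` form a final
  -- segment. `P′` is `P` enlarged by the chain.
  pathBags-chain : ∀ {R : Fin n → Set} {P} as g → Within R P → All R as →
                   ∃₂ λ P′ Xs → pathBags P (chain as g) ≡ pathBags P′ g ++ Xs × Within R P′ × All (Within R) Xs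
  pathBags-chain {P = P} []       g w _        = P , [] , sym (++-identityʳ _) , w , []
  pathBags-chain         (a ∷ as) g w (r ∷ rs) =
    let P′ , Xs , e , w′ , ws = pathBags-chain as g (within-insert r w) rs in
    P′ , Xs ++ _ ∷ [] , trans (cong (_++ _ ∷ []) e) (++-assoc (pathBags P′ g) Xs _) , w′ ,
    All.++⁺ ws (within-insert r w ∷ [])

  sum-tabulate : ∀ {n} (f : Fin n → ℕ) → ListAction.sum (tabulate f) ≡ sum f
  sum-tabulate {zero}  f = refl
  sum-tabulate {suc n} f = cong (ℕ._+_ _) (sum-tabulate (f ∘ suc))

  sum-map-++ : ∀ (f : A → ℕ) xs ys →
               ListAction.sum (map f (xs ++ ys)) ≡ ListAction.sum (map f xs) + ListAction.sum (map f ys)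
  sum-map-++ f xs ys = trans (cong ListAction.sum (map-++ f xs ys)) (sum-++ (map f xs) (map f ys))

  sum-map-allFin : ∀ {n} (f : A → ℕ) (g : Fin n → A) → ListAction.sum (map f (map g (allFin n))) ≡ sum (f ∘ g)
  sum-map-allFin f g rewrite map-tabulate id g | map-tabulate g f = sum-tabulate (f ∘ g)

  sum-map-concatMap : ∀ (f : A → ℕ) (F : B → List A) xs →
                      ListAction.sum (map f (concatMap F xs)) ≡ ListAction.sum (map (λ x → ListAction.sum (map f (F x))) xs)
  sum-map-concatMap f F []       = refl
  sum-map-concatMap f F (x ∷ xs) rewrite map-++ f (F x) (concatMap F xs) | sum-++ (map f (F x)) (map f (concatMap F xs)) =
    cong (ℕ._+_ _) (sum-map-concatMap f F xs)

  sum-allFin : ∀ {n} (f : Fin n → ℕ) → ListAction.sum (map f (allFin n)) ≡ sum f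
  sum-allFin f rewrite map-tabulate id f = sum-tabulate f

  ∣∣-sum : (S : Subset n) → ∣ S ∣ ≡ sum (λ i → bit (Vec.lookup S i))
  ∣∣-sum Vec.[]          = refl
  ∣∣-sum (true Vec.∷ S)  = cong suc (∣∣-sum S)
  ∣∣-sum (false Vec.∷ S) = ∣∣-sum S

  unique-concatMap : ∀ {F : B → List A} {xs} → (∀ x → Unique (F x)) → (∀ {x y} → x ≢ y → Disjoint (F x) (F y)) →
                     Unique xs → Unique (concatMap F xs)
  unique-concatMap U D V = Unique.concat⁺ (All.map⁺ (All.universal U _)) (AllPairs.map⁺ (AllPairs.map D V))

  -- The graphs, their common elimination forest, and their covers.

  module Construction (p N : ℕ) (mem : Fin N → Fin (suc p * suc p) → Bool) (x₀ : Fin N) where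
    open Gadgets p N mem

    rowForest : Fin N → Fin (suc p) → Forest V
    rowForest x r = chain (map (cell x r) (allFin (suc (suc p)))) []

    -- The rows are siblings below the hub clique, so a root path meets the cells of one row only.
    gadgetForest : Fin N → Forest V
    gadgetForest x = chain (map (hub x) (allFin (suc p))) (concatMap (rowForest x) (allFin (suc p)))

    askForest : Fin (suc p * suc p) → Forest V
    askForest i = node (ask i) [] ∷ []

    gadgetForests askForests : Forest V
    gadgetForests = concatMap gadgetForest (allFin N)
    askForests    = concatMap askForest (allFin (suc p * suc p))

    boundary : List V
    boundary = map bd (allFin (suc p * suc p))

    -- The order matters: in postorder all gadgets precede the asking vertices, and the boundary
    -- comes last.
    forest : Forest V
    forest = chain boundary (gadgetForests ++ askForests)

    cells-of : Fin N → Fin (suc p) → List V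
    cells-of x r = map (cell x r) (allFin (suc (suc p)))

    gadget-of : Fin N → List V
    gadget-of x = map (hub x) (allFin (suc p)) ++ concatMap (cells-of x) (allFin (suc p))

    asks : List V
    asks = concatMap (λ i → ask i ∷ []) (allFin (suc p * suc p))

    vertices : List V
    vertices = boundary ++ concatMap gadget-of (allFin N) ++ asks

    labels-row : ∀ x r → labels (rowForest x r) ≡ cells-of x r
    labels-row x r = trans (labels-chain (cells-of x r) []) (++-identityʳ _)

    labels-rows : ∀ x → labels (concatMap (rowForest x) (allFin (suc p))) ≡ concatMap (cells-of x) (allFin (suc p))
    labels-rows x = trans (labels-concatMap (rowForest x) (allFin (suc p))) (concatMap-cong (labels-row x) (allFin (suc p)))

    labels-gadget : ∀ x → labels (gadgetForest x) ≡ gadget-of x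
    labels-gadget x = trans (labels-chain (map (hub x) (allFin (suc p))) _) (cong (map (hub x) (allFin (suc p)) ++_) (labels-rows x))

    labels-gadgets : labels gadgetForests ≡ concatMap gadget-of (allFin N)
    labels-gadgets = trans (labels-concatMap gadgetForest (allFin N)) (concatMap-cong labels-gadget (allFin N))

    labels-asks : labels askForests ≡ asks
    labels-asks = labels-concatMap askForest (allFin (suc p * suc p))

    labels-forest : labels forest ≡ vertices
    labels-forest = trans (labels-chain boundary _) (cong (boundary ++_)
      (trans (labels-++ gadgetForests askForests) (cong₂ _++_ labels-gadgets labels-asks)))

    -- A longest root path takes the boundary, one hub clique and one row; with `q = 1 + p` this
    -- gives (1 + q)². `x₀` guarantees that there is a gadget at all.
    height-forest : height forest ≡ suc p * suc p + (suc p + suc (suc p))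
    height-forest = trans (height-chain boundary _) (cong₂ _+_ (length-map-allFin bd)
      (trans (height-++ gadgetForests askForests) (trans (cong₂ _⊔_
        (height-concatMap gadgetForest height-gadget (∈-allFin x₀))
        (height-concatMap askForest {x = zero} {allFin (suc p * suc p)} (λ _ → refl) (here refl)))
      (ℕ.m≥n⇒m⊔n≡m {m = suc p + suc (suc p)} (s≤s z≤n)))))
      where
      length-map-allFin : ∀ {m} (f : Fin m → V) → length (map f (allFin m)) ≡ m
      length-map-allFin f = trans (length-map f (allFin _)) (length-tabulate id)

      height-row : ∀ x r → height (rowForest x r) ≡ suc (suc p)
      height-row x r = trans (height-chain (cells-of x r) []) (trans (ℕ.+-identityʳ _) (length-map-allFin (cell x r)))

      height-gadget : ∀ x → height (gadgetForest x) ≡ suc p + suc (suc p)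
      height-gadget x = trans (height-chain (map (hub x) (allFin (suc p))) _) (cong₂ _+_ (length-map-allFin (hub x))
        (height-concatMap (rowForest x) {x = zero} {allFin (suc p)} (height-row x) (here refl)))

    hub-∈ : ∀ x r → hub x r ∈ˡ map (hub x) (allFin (suc p))
    hub-∈ x r = ∈-map⁺ (hub x) (∈-allFin r)

    cell-∈ : ∀ x r s → cell x r s ∈ˡ concatMap (cells-of x) (allFin (suc p))
    cell-∈ x r s = ∈-concatMap⁺ (cells-of x) (Any.map (λ { refl → ∈-map⁺ (cell x r) (∈-allFin s) }) (∈-allFin r))

    in-gadget : ∀ {v} x → v ∈ˡ gadget-of x → v ∈ˡ concatMap gadget-of (allFin N)
    in-gadget x m = ∈-concatMap⁺ gadget-of (Any.map (λ { refl → m }) (∈-allFin x))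

    ask-∈ : ∀ i → ask i ∈ˡ asks
    ask-∈ i = ∈-concatMap⁺ (λ i → ask i ∷ []) (Any.map (λ { refl → here refl }) (∈-allFin i))

    vertices-complete : ∀ v → v ∈ˡ vertices
    vertices-complete (bd i)       = ∈-++⁺ˡ (∈-map⁺ bd (∈-allFin i))
    vertices-complete (hub x r)    = ∈-++⁺ʳ boundary (∈-++⁺ˡ (in-gadget x (∈-++⁺ˡ (hub-∈ x r))))
    vertices-complete (cell x r s) = ∈-++⁺ʳ boundary (∈-++⁺ˡ (in-gadget x (∈-++⁺ʳ (map (hub x) (allFin (suc p))) (cell-∈ x r s))))
    vertices-complete (ask i)      = ∈-++⁺ʳ boundary (∈-++⁺ʳ (concatMap gadget-of (allFin N)) (ask-∈ i))

    data InBoundary : V → Set where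
      bd : ∀ {i} → InBoundary (bd i)

    data InGadget (x : Fin N) : V → Set where
      hub  : ∀ {r} → InGadget x (hub x r)
      cell : ∀ {r s} → InGadget x (cell x r s)

    data InAsk : V → Set where
      ask : ∀ {i} → InAsk (ask i)

    data InRow (x : Fin N) (r : Fin (suc p)) : V → Set where
      cell : ∀ {s} → InRow x r (cell x r s)

    boundary⁻ : ∀ {v} → v ∈ˡ boundary → InBoundary v
    boundary⁻ m with (_ , _ , refl) ← ∈-map⁻ bd m = bd

    cells⁻ : ∀ {v} x r → v ∈ˡ cells-of x r → InRow x r v
    cells⁻ x r m with (_ , _ , refl) ← ∈-map⁻ (cell x r) m = cell

    gadget⁻ : ∀ {v} x → v ∈ˡ gadget-of x → InGadget x v
    gadget⁻ x m with ∈-++⁻ (map (hub x) (allFin (suc p))) m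
    ... | inj₁ h with (_ , _ , refl) ← ∈-map⁻ (hub x) h = hub
    gadget⁻ x m | inj₂ c with Any.satisfied (∈-concatMap⁻ (cells-of x) {xs = allFin (suc p)} c)
    ... | r , d with cell ← cells⁻ x r d = cell

    gadgets⁻ : ∀ {v} → v ∈ˡ concatMap gadget-of (allFin N) → ∃[ x ] InGadget x v
    gadgets⁻ m = let x , i = Any.satisfied (∈-concatMap⁻ gadget-of {xs = allFin N} m) in x , gadget⁻ x i

    asks⁻ : ∀ {v} → v ∈ˡ asks → InAsk v
    asks⁻ m with (_ , here refl) ← Any.satisfied (∈-concatMap⁻ (λ i → ask i ∷ []) {xs = allFin (suc p * suc p)} m) = ask

    vertices-unique : Unique vertices
    vertices-unique = Unique.++⁺ (Unique.map⁺ (λ { refl → refl }) (Unique.allFin⁺ _))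
      (Unique.++⁺ (unique-concatMap gadget-unique
          (λ n (a , b) → gadgets-disjoint n (gadget⁻ _ a) (gadget⁻ _ b)) (Unique.allFin⁺ N))
        (unique-concatMap {F = λ i → ask i ∷ []} (λ _ → [] ∷ []) (λ { n (here refl , here refl) → n refl }) (Unique.allFin⁺ _))
        λ (a , b) → gadget-ask (proj₂ (gadgets⁻ a)) (asks⁻ b))
      λ (a , b) → [ (λ g → boundary-gadget (boundary⁻ a) (proj₂ (gadgets⁻ g))) , (λ c → boundary-ask (boundary⁻ a) (asks⁻ c)) ]′
        (∈-++⁻ (concatMap gadget-of (allFin N)) b)
      where
      rows-disjoint : ∀ {x r r′ v} → r ≢ r′ → InRow x r v → InRow x r′ v → ⊥
      rows-disjoint n cell cell = n refl

      gadgets-disjoint : ∀ {x y v} → x ≢ y → InGadget x v → InGadget y v → ⊥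
      gadgets-disjoint n hub  hub  = n refl
      gadgets-disjoint n cell cell = n refl

      gadget-ask : ∀ {x v} → InGadget x v → InAsk v → ⊥
      gadget-ask hub ()

      boundary-gadget : ∀ {x v} → InBoundary v → InGadget x v → ⊥
      boundary-gadget bd ()

      boundary-ask : ∀ {v} → InBoundary v → InAsk v → ⊥
      boundary-ask bd ()

      hub-row : ∀ {x r v} → v ∈ˡ map (hub x) (allFin (suc p)) → InRow x r v → ⊥
      hub-row {x} m cell with () ← proj₂ (proj₂ (∈-map⁻ (hub x) m))

      gadget-unique : ∀ x → Unique (gadget-of x)
      gadget-unique x = Unique.++⁺ (Unique.map⁺ (λ { refl → refl }) (Unique.allFin⁺ _))
        (unique-concatMap (λ r → Unique.map⁺ (λ { refl → refl }) (Unique.allFin⁺ _))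
          (λ n (a , b) → rows-disjoint n (cells⁻ x _ a) (cells⁻ x _ b)) (Unique.allFin⁺ _))
        λ (a , b) → let r , c = Any.satisfied (∈-concatMap⁻ (cells-of x) {xs = allFin (suc p)} b) in
          hub-row a (cells⁻ x r c)

    gadget-above : ∀ {x u v} → Above (gadgetForest x) u v → Above forest u v
    gadget-above {x} a = above-chain boundary (above-++ˡ (above-concatMap gadgetForest (∈-allFin x) a))

    row-above : ∀ {x r u v} → Above (rowForest x r) u v → Above forest u v
    row-above {x} {r} a = gadget-above {x} (above-chain (map (hub x) (allFin (suc p)))
      (above-concatMap (rowForest x) (∈-allFin r) a))

    hub-above-cell : ∀ x r s → Above forest (hub x r) (cell x r s)
    hub-above-cell x r s = gadget-above {x} (above-chain-end (hub-∈ x r)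
      (subst (cell x r s ∈ˡ_) (sym (labels-rows x)) (cell-∈ x r s)))

    boundary-above : ∀ i {v} → v ∈ˡ concatMap gadget-of (allFin N) ++ asks → Above forest (bd i) v
    boundary-above i {v} m = above-chain-end (∈-map⁺ bd (∈-allFin i)) (subst (v ∈ˡ_)
      (sym (trans (labels-++ gadgetForests askForests) (cong₂ _++_ labels-gadgets labels-asks))) m)

    edge-vertical : ∀ {on X u v} → Edge on X u v → Above forest u v ⊎ Above forest v u
    edge-vertical (hubs {x} {r} {r′} n) = Sum.map (gadget-above {x}) (gadget-above {x})
      (above-chain-within (hub-∈ x r) (hub-∈ x r′) λ { refl → n refl })
    edge-vertical (cells {x} {r} {s} {s′} n) = Sum.map (row-above {x} {r}) (row-above {x} {r})
      (above-chain-within (∈-map⁺ (cell x r) (∈-allFin s)) (∈-map⁺ (cell x r) (∈-allFin s′)) λ { refl → n refl })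
    edge-vertical (row {x} {r})             = inj₂ (hub-above-cell x r zero)
    edge-vertical (blocked {x} {r} {s} _ _) = inj₂ (hub-above-cell x r (suc s))
    edge-vertical (column {x} {r} {s} _ _)  = inj₂ (boundary-above _ (∈-++⁺ˡ
      (in-gadget x (∈-++⁺ʳ (map (hub x) (allFin (suc p))) (cell-∈ x r (suc s))))))
    edge-vertical (asked {i} _) = inj₂ (boundary-above i (∈-++⁺ʳ (concatMap gadget-of (allFin N)) (ask-∈ i)))

    order : ℕ
    order = length vertices

    number : V → Fin order
    number v = index (vertices-complete v)

    vertex : Fin order → V
    vertex = lookup vertices

    vertex-number : ∀ v → vertex (number v) ≡ v
    vertex-number v = sym (Any.lookup-index (vertices-complete v))

    number-vertex : ∀ i → number (vertex i) ≡ i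
    number-vertex i = lookup-injective vertices-unique _ _ (vertex-number (vertex i))

    number-injective : ∀ {u v} → number u ≡ number v → u ≡ v
    number-injective {u} {v} e = trans (sym (vertex-number u)) (trans (cong vertex e) (vertex-number v))

    module _ (on : Fin N → Bool) (X : Fin (suc p * suc p) → Bool) where

      graph : Graph
      graph = record
        { order     = order
        ; adjacent  = λ i j → ⌊ edge? on X (vertex i) (vertex j) ⊎-dec edge? on X (vertex j) (vertex i) ⌋
        ; symmetric = λ i j → isYes-⇔ Sum.swap Sum.swap _ _
        ; loopless  = λ i → isYes-false [ irreflexive , irreflexive ]′ _
        }

      adjacent⁻ : ∀ {i j} → Graph.Adj graph i j → Edge on X (vertex i) (vertex j) ⊎ Edge on X (vertex j) (vertex i)
      adjacent⁻ {i} {j} = toWitness {a? = edge? on X (vertex i) (vertex j) ⊎-dec edge? on X (vertex j) (vertex i)}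

      adjacent⁺ : ∀ {u v} → Edge on X u v → Graph.Adj graph (number u) (number v)
      adjacent⁺ {u} {v} e = fromWitness
        {a? = edge? on X (vertex (number u)) (vertex (number v)) ⊎-dec edge? on X (vertex (number v)) (vertex (number u))}
        (inj₁ (subst₂ (Edge on X) (sym (vertex-number u)) (sym (vertex-number v)) e))

    sum-vertices : ∀ χ → ListAction.sum (map (bit ∘ χ) vertices) ≡ cost χ
    sum-vertices χ = trans (sum-map-++ f boundary (concatMap gadget-of (allFin N) ++ asks))
      (cong₂ _+_ (sum-map-allFin f bd) (trans (sum-map-++ f (concatMap gadget-of (allFin N)) asks)
        (cong₂ _+_
          (trans (sum-map-concatMap f gadget-of (allFin N)) (trans (sum-allFin {N} (λ x → ListAction.sum (map f (gadget-of x)))) (sum-cong-≗ {N} gadget)))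
          (trans (sum-map-concatMap f (λ i → ask i ∷ []) (allFin (suc p * suc p)))
            (trans (sum-allFin {suc p * suc p} (λ i → f (ask i) + 0)) (sum-cong-≗ {suc p * suc p} λ i → ℕ.+-identityʳ (f (ask i))))))))
      where
      f = bit ∘ χ

      gadget : ∀ x → ListAction.sum (map f (gadget-of x)) ≡ gadgetCost χ x
      gadget x = trans (sum-map-++ f (map (hub x) (allFin (suc p))) (concatMap (cells-of x) (allFin (suc p))))
        (cong₂ _+_ (sum-map-allFin f (hub x))
          (trans (sum-map-concatMap f (cells-of x) (allFin (suc p)))
            (trans (sum-allFin {suc p} (λ r → ListAction.sum (map f (cells-of x r)))) (sum-cong-≗ {suc p} λ r → sum-map-allFin f (cell x r)))))

    ∣∣-cost : ∀ S → ∣ S ∣ ≡ cost (Vec.lookup S ∘ number)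
    ∣∣-cost S = trans (∣∣-sum S) (trans (sum-cong-≗ {order} λ i → cong (bit ∘ Vec.lookup S) (sym (number-vertex i)))
      (trans (sym (sum-tabulate (f ∘ vertex))) (trans (cong ListAction.sum (sym (map-tabulate vertex f)))
        (trans (cong (ListAction.sum ∘ map f) (tabulate-lookup vertices)) (sum-vertices (Vec.lookup S ∘ number))))))
      where
      f : V → ℕ
      f v = bit (Vec.lookup S (number v))

    cover-> : ∀ {on X} x → T (on x) → mem x ≗ X → ¬ VertexCover (graph on X) (+ budget X)
    cover-> {on} {X} x o same (S , covers , ≤ξ) = ℕ.<⇒≱ (cost-> χ-covers x o same)
      (subst (ℕ._≤ budget X) (∣∣-cost S) (ℤ.drop‿+≤+ ≤ξ))
      where
      χ-covers : Covers on X (Vec.lookup S ∘ number)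
      χ-covers e = Sum.map in-S in-S (covers _ _ (adjacent⁺ on X e))
        where
        in-S : ∀ {v} → number v ∈ S → T (Vec.lookup S (number v))
        in-S m = subst T (sym (Vec.[]=⇒lookup m)) _

    cost-cong : ∀ {χ χ′} → χ ≗ χ′ → cost χ ≡ cost χ′
    cost-cong {χ} {χ′} e = trans (sym (sum-vertices χ))
      (trans (cong ListAction.sum (map-cong (cong bit ∘ e) vertices)) (sum-vertices χ′))

    cover-≤ : ∀ {on X} → (∀ x → T (on x) → ∃[ i ] T (X i) × ¬ T (mem x i)) → VertexCover (graph on X) (+ budget X)
    cover-≤ {on} {X} h = S , covers , ℤ.+≤+ (ℕ.≤-reflexive (trans (∣∣-cost S) (trans (cost-cong lookup-S) (cheap-cost on X h))))
      where
      χ : V → Bool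
      χ = cheap on X h

      S : Subset order
      S = Vec.tabulate (χ ∘ vertex)

      lookup-S : (Vec.lookup S ∘ number) ≗ χ
      lookup-S v = trans (Vec.lookup∘tabulate (χ ∘ vertex) (number v)) (cong χ (vertex-number v))

      in-S : ∀ {i} → T (χ (vertex i)) → i ∈ S
      in-S {i} t = Vec.lookup⇒[]= i S (trans (Vec.lookup∘tabulate (χ ∘ vertex) i) (Equivalence.to T-≡ t))

      covers : IsVertexCover (graph on X) S
      covers i j a = [ (λ e → Sum.map in-S in-S (cheap-covers on X h e)) ,
                       (λ e → Sum.swap (Sum.map in-S in-S (cheap-covers on X h e))) ]′ (adjacent⁻ on X {i} {j} a)

  -- Cutting the encoding into a prefix and a suffix.

  map-split : ∀ {A B : Set} (f : A → B) zs xs {ys} → map f zs ≡ xs ++ ys →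
              ∃₂ λ zs₁ zs₂ → zs ≡ zs₁ ++ zs₂ × map f zs₁ ≡ xs × map f zs₂ ≡ ys
  map-split f zs       []       e    = [] , zs , refl , refl , e
  map-split f (z ∷ zs) (x ∷ xs) e with refl ← ∷-injectiveˡ e =
    let zs₁ , zs₂ , e₀ , e₁ , e₂ = map-split f zs xs (∷-injectiveʳ e) in
    z ∷ zs₁ , zs₂ , cong (z ∷_) e₀ , cong (x ∷_) e₁ , e₂

  within-map : ∀ {n} {R S : Fin n → Set} {X} → (∀ {u} → R u → S u) → Within R X → Within S X
  within-map h w i = h (w i)

  -- R and S single out the vertices allowed in the bags before and after the point where
  -- the encoding is cut; i matters only before it and j only after it.
  module Layout
    {n : ℕ} (v : Fin n) (g : Forest (Fin n)) (fresh : Fresh ∅ (node v g ∷ []))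
    (complete : ∀ u → u ∈ˡ labels (node v g ∷ []))
    {I J : Set} (i₀ : I) (j₀ : J)
    (adjacent : I → J → Fin n → Fin n → Bool)
    (symmetric : ∀ i j u w → adjacent i j u w ≡ adjacent i j w u)
    (loopless : ∀ i j u → adjacent i j u u ≡ false)
    (vertical : ∀ i j u w → T (adjacent i j u w) → Above (node v g ∷ []) u w ⊎ Above (node v g ∷ []) w u)
    (R S : Fin n → Set)
    (Xs Ys : List (Subset n)) (bags-split : pathBags ∅ (node v g ∷ []) ≡ Xs ++ Ys)
    (Xs-R : All (Within R) Xs) (Ys-S : All (Within S) Ys)
    (local-R : ∀ i j {u w} → R u → R w → adjacent i j u w ≡ adjacent i j₀ u w)
    (local-S : ∀ i j {u w} → S u → S w → adjacent i j u w ≡ adjacent i₀ j u w)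
    where

    private
      numbered : Forest (Fin n)
      numbered = node v g ∷ []

    graph : I → J → Graph
    graph i j = record
      { order = n ; adjacent = adjacent i j ; symmetric = symmetric i j ; loopless = loopless i j }

    decomposition : ∀ κ i j → Decomposition κ (graph i j)
    decomposition tree      i j = PathDecomposition.treeDecomposition
      (pathDecomposition (graph i j) v g fresh complete (vertical i j))
    decomposition path      i j = pathDecomposition (graph i j) v g fresh complete (vertical i j)
    decomposition treedepth i j = treedepthDecomposition (graph i j) v g fresh complete (vertical i j)

    -- The forest is shared by all graphs, so the separators of the reference pair `i₀`, `j₀` are
    -- those of every pair.
    seps : Kind → List (Separator n)
    seps κ = separators κ (decomposition κ i₀ j₀)

    separators≡ : ∀ κ i j → separators κ (decomposition κ i j) ≡ seps κ
    separators≡ tree      i j = refl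
    separators≡ path      i j = refl
    separators≡ treedepth i j = refl

    bags : ∀ κ → map Separator.bag (seps κ) ≡ pathBags ∅ numbered
    bags tree      = bags-pathDecomposition (graph i₀ j₀) v g fresh complete (vertical i₀ j₀)
    bags path      = bags-pathDecomposition (graph i₀ j₀) v g fresh complete (vertical i₀ j₀)
    bags treedepth = postorder-rootPaths ∅ numbered

    peeled : ∀ κ → All Peeled (seps κ)
    peeled tree      = peeled-pathDecomposition (graph i₀ j₀) v g fresh complete (vertical i₀ j₀)
    peeled path      = peeled-pathDecomposition (graph i₀ j₀) v g fresh complete (vertical i₀ j₀)
    peeled treedepth = peeled-rootPaths ∅ numbered

    depth : ℕ
    depth = height numbered

    parameter : Kind → ℕ
    parameter tree      = depth ∸ 1
    parameter path      = depth ∸ 1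
    parameter treedepth = depth

    width≡ : ∀ κ i j → width κ (decomposition κ i j) ≡ parameter κ
    width≡ treedepth i j = refl
    width≡ path i j = cong (_∸ 1) (trans (cong (max 0) (trans (map-∘ (seps path)) (cong (map ∣_∣) (bags path))))
      (max-pathBags numbered fresh))
    width≡ tree i j = width≡ path i j

    size≡ : ∀ κ i j → size κ (decomposition κ i j) ≡ length (labels numbered)
    size≡ κ i j = trans (cong length (separators≡ κ i j)) (trans (sym (length-map Separator.bag (seps κ)))
      (trans (cong length (bags κ)) (length-pathBags ∅ numbered)))

    parameter-≥ : ∀ κ → depth ∸ 1 ≤ parameter κ
    parameter-≥ tree      = ℕ.≤-refl
    parameter-≥ path      = ℕ.≤-refl
    parameter-≥ treedepth = ℕ.m∸n≤m depth 1

    bag-≤ : ∀ κ → All (λ s → ∣ Separator.bag s ∣ ≤ depth) (seps κ)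
    bag-≤ κ = All.map⁻ (subst (All (λ X → ∣ X ∣ ≤ depth)) (sym (bags κ))
      (All.map (λ l → ℕ.≤-trans l (ℕ.≤-reflexive (cong (_+ depth) (∣⊥∣≡0 n)))) (pathBags-≤ numbered fresh)))

    compact : ∀ κ i j → Compact κ (decomposition κ i j)
    compact κ i j =
      subst (All (λ s → length (listedEdges (graph i j) s) ≤ width κ (decomposition κ i j))) (sym (separators≡ κ i j))
        (All.zipWith (λ {s} (l , b) → ℕ.≤-trans (length-listed (graph i j) s l) (ℕ.≤-trans (ℕ.∸-monoˡ-≤ 1 b)
          (ℕ.≤-trans (parameter-≥ κ) (ℕ.≤-reflexive (sym (width≡ κ i j)))))) (peeled κ , bag-≤ κ))

    inst : ∀ κ → I → J → ℤ → Instance κ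
    inst κ i j ξ = record
      { graph = graph i j ; decomposition = decomposition κ i j ; compact = compact κ i j ; ξ = ξ }

    encode-R : ∀ i j s → Within R (Separator.bag s) → encodeSeparator (graph i j) s ≡ encodeSeparator (graph i j₀) s
    encode-R i j s w = encodeSeparator-local
      {A = adjacent i j} {adjacent i j₀} {symmetric i j} {symmetric i j₀} {loopless i j} {loopless i j₀} s
      λ a b → local-R i j (w a) (w b)

    encode-S : ∀ i j s → Within S (Separator.bag s) → encodeSeparator (graph i j) s ≡ encodeSeparator (graph i₀ j) s
    encode-S i j s w = encodeSeparator-local
      {A = adjacent i j} {adjacent i₀ j} {symmetric i j} {symmetric i₀ j} {loopless i j} {loopless i₀ j} s
      λ a b → local-S i j (w a) (w b)

    seps-split : ∀ κ → ∃₂ λ ss ss′ → seps κ ≡ ss ++ ss′ ×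
                 All (Within R ∘ Separator.bag) ss × All (Within S ∘ Separator.bag) ss′
    seps-split κ =
      let ss , ss′ , e₀ , e₁ , e₂ = map-split Separator.bag (seps κ) Xs (trans (bags κ) bags-split) in
      ss , ss′ , e₀ , All.map⁻ (subst (All (Within R)) (sym e₁) Xs-R) ,
      All.map⁻ (subst (All (Within S)) (sym e₂) Ys-S)

    prefix : Kind → I → List Symbol
    prefix κ i = numeral (parameter κ) ++ hash ∷ concatMap (encodeSeparator (graph i j₀)) (proj₁ (seps-split κ))

    -- The threshold ends the encoding, so it may vary with the question without touching the
    -- prefix.
    suffix : Kind → J → ℤ → List Symbol
    suffix κ j ξ = concatMap (encodeSeparator (graph i₀ j)) (proj₁ (proj₂ (seps-split κ))) ++ encodeℤ ξ

    encoding≡ : ∀ κ i j ξ → Instance.encoding (inst κ i j ξ) ≡ prefix κ i ++ suffix κ j ξ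
    encoding≡ κ i j ξ = let ss , ss′ , e , w , w′ = seps-split κ in trans
      (cong₂ (λ k zs → numeral k ++ hash ∷ concatMap (encodeSeparator (graph i j)) zs ++ encodeℤ ξ)
        (width≡ κ i j) (trans (separators≡ κ i j) e))
      (trans (cong (λ zs → numeral (parameter κ) ++ hash ∷ zs ++ encodeℤ ξ)
          (trans (concatMap-++ (encodeSeparator (graph i j)) ss ss′) (cong₂ _++_
            (cong concat (map-cong-local (All.map (λ {s} → encode-R i j s) w)))
            (cong concat (map-cong-local (All.map (λ {s} → encode-S i j s) w′))))))
        (trans (cong (λ zs → numeral (parameter κ) ++ hash ∷ zs) (++-assoc (concatMap (encodeSeparator (graph i j₀)) ss) _ _))
          (sym (++-assoc (numeral (parameter κ)) _ _))))

  -- The cut placed between the gadgets and the asking vertices.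

  module Instances (p N : ℕ) (mem : Fin N → Fin (suc p * suc p) → Bool) (x₀ : Fin N) where
    open Gadgets p N mem
    open Construction p N mem x₀

    -- `forest` without its root, the boundary vertex `zero`: `Layout` takes the root separately,
    -- because a path needs a first bag.
    body : Forest V
    body = chain (map bd (tabulate suc)) (gadgetForests ++ askForests)

    top : Fin order
    top = number (bd zero)

    numbered : Forest (Fin order)
    numbered = node top (relabel number body) ∷ []

    labels-numbered : labels numbered ≡ map number vertices
    labels-numbered = trans (labels-relabel number forest) (cong (map number) labels-forest)

    fresh : Fresh ∅ numbered
    fresh = subst Unique (sym labels-numbered) (Unique.map⁺ number-injective vertices-unique) , λ _ → ∉⊥
      where open import Data.List.Relation.Unary.Unique.Propositional using (Unique)

    complete : ∀ u → u ∈ˡ labels numbered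
    complete u = subst (u ∈ˡ_) (sym labels-numbered)
      (subst (_∈ˡ map number vertices) (number-vertex u) (∈-map⁺ number (∈-lookup u)))

    vertical : ∀ on X u w → Graph.Adj (graph on X) u w → Above numbered u w ⊎ Above numbered w u
    vertical on X u w a = [ Sum.map lift lift ∘ edge-vertical , Sum.swap ∘ Sum.map lift lift ∘ edge-vertical ]′
      (adjacent⁻ on X {u} {w} a)
      where
      lift : ∀ {u w} → Above forest (vertex u) (vertex w) → Above numbered u w
      lift {u} {w} b = subst₂ (Above numbered) (number-vertex u) (number-vertex w) (Above-relabel number b)

    height-numbered : height numbered ≡ suc p * suc p + (suc p + suc (suc p))
    height-numbered = trans (height-relabel number forest) height-forest

    none : ∀ {A : Set} → A → Bool
    none _ = false

    NotAsk NotGadget : Fin order → Set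
    NotAsk u    = ¬ InAsk (vertex u)
    NotGadget u = ∀ x → ¬ InGadget x (vertex u)

    -- The cut falls after the last gadget bag. The bags of the boundary chain are put behind it;
    -- they contain no gadget vertices.
    bags-split : ∃₂ λ Xs Ys → pathBags ∅ numbered ≡ Xs ++ Ys × All (Within NotAsk) Xs × All (Within NotGadget) Ys
    bags-split with pathBags-chain {R = InBoundary ∘ vertex} {∅} (map number boundary)
                      (relabel number gadgetForests ++ relabel number askForests) (λ i → contradiction i ∉⊥)
                      (All.map⁺ (All.tabulate λ {v} m → subst InBoundary (sym (vertex-number v)) (boundary⁻ m)))
    ... | P , Zs , e , wP , wZs =
      pathBags P (relabel number gadgetForests) , pathBags P (relabel number askForests) ++ Zs ,
      trans (cong (pathBags ∅) (trans (relabel-chain number boundary (gadgetForests ++ askForests))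
          (cong (chain (map number boundary)) (relabel-++ number gadgetForests askForests))))
        (trans e (trans (cong (_++ Zs) (pathBags-++ P (relabel number gadgetForests) (relabel number askForests)))
          (++-assoc (pathBags P (relabel number gadgetForests)) _ Zs))) ,
      pathBags-within (relabel number gadgetForests) (within-map {X = P} boundary-not-ask wP)
        (subst (All NotAsk) (sym (trans (labels-relabel number gadgetForests) (cong (map number) labels-gadgets)))
          (All.map⁺ (All.tabulate λ {v} m → subst (¬_ ∘ InAsk) (sym (vertex-number v)) (gadget-not-ask (proj₂ (gadgets⁻ m)))))) ,
      All.++⁺ (pathBags-within (relabel number askForests) (within-map {X = P} boundary-not-gadget wP)
          (subst (All NotGadget) (sym (trans (labels-relabel number askForests) (cong (map number) labels-asks)))
            (All.map⁺ (All.tabulate λ {v} m → subst (λ v → ∀ x → ¬ InGadget x v) (sym (vertex-number v)) (ask-not-gadget (asks⁻ m))))))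
        (All.map (λ {X} → within-map {X = X} boundary-not-gadget) wZs)
      where
      boundary-not-ask : ∀ {v} → InBoundary v → ¬ InAsk v
      boundary-not-ask bd ()

      gadget-not-ask : ∀ {x v} → InGadget x v → ¬ InAsk v
      gadget-not-ask hub ()

      boundary-not-gadget : ∀ {v} → InBoundary v → ∀ x → ¬ InGadget x v
      boundary-not-gadget bd x ()

      ask-not-gadget : ∀ {v} → InAsk v → ∀ x → ¬ InGadget x v
      ask-not-gadget ask x ()

    -- `Edge` is oriented so that all edges governed by `X` start at an asking vertex; hence looking
    -- at the first end is enough. Likewise all edges governed by `on` start in a gadget.
    change-asked : ∀ {on X X′ u v} → ¬ InAsk u → Edge on X u v → Edge on X′ u v
    change-asked _ (hubs n)      = hubs n
    change-asked _ (cells n)     = cells n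
    change-asked _ row           = row
    change-asked _ (blocked o m) = blocked o m
    change-asked _ (column o m)  = column o m
    change-asked n (asked _)     = contradiction ask n

    change-on : ∀ {on on′ X u v} → (∀ x → ¬ InGadget x u) → Edge on X u v → Edge on′ X u v
    change-on n (hubs _)      = contradiction hub (n _)
    change-on n (cells _)     = contradiction cell (n _)
    change-on n row           = contradiction cell (n _)
    change-on n (blocked _ _) = contradiction cell (n _)
    change-on n (column _ _)  = contradiction cell (n _)
    change-on _ (asked a)     = asked a

    module Layout′ = Layout top (relabel number body) fresh complete none none
      (λ on X → Graph.adjacent (graph on X)) (λ on X → Graph.symmetric (graph on X)) (λ on X → Graph.loopless (graph on X))
      vertical NotAsk NotGadget (proj₁ bags-split) (proj₁ (proj₂ bags-split)) (proj₁ (proj₂ (proj₂ bags-split)))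
      (proj₁ (proj₂ (proj₂ (proj₂ bags-split)))) (proj₂ (proj₂ (proj₂ (proj₂ bags-split))))
      (λ on X a b → isYes-⇔ (Sum.map (change-asked a) (change-asked b)) (Sum.map (change-asked a) (change-asked b)) _ _)
      (λ on X a b → isYes-⇔ (Sum.map (change-on a) (change-on b)) (Sum.map (change-on a) (change-on b)) _ _)

  -- Different families of sets need different outcomes at the cut.

  isOne : Fin 2 → Bool
  isOne zero    = false
  isOne (suc _) = true

  isOne-injective : ∀ {a b} → (T (isOne a) → T (isOne b)) → (T (isOne b) → T (isOne a)) → a ≡ b
  isOne-injective {zero}     {zero}     f g = refl
  isOne-injective {zero}     {suc _}    f g with () ← g _
  isOne-injective {suc _}    {zero}     f g with () ← f _
  isOne-injective {suc zero} {suc zero} f g = refl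

  mem : ∀ {w} → Fin (2 ^ w) → Fin w → Bool
  mem {w} x i = isOne (finToFun {2} {w} x i)

  mem-injective : ∀ {w} {x y : Fin (2 ^ w)} → (∀ i → T (mem x i) → T (mem y i)) → (∀ i → T (mem y i) → T (mem x i)) → x ≡ y
  mem-injective {w} f g = finToFun-injective {2} {w} λ i → isOne-injective (f i) (g i)

  module Counting
    (w : ℕ) (κ : Kind) (M : DPTM) (solves : Solves VertexCover κ M)
    (inst : (Fin (2 ^ w) → Bool) → (Fin w → Bool) → ℤ → Instance κ)
    (prefix : (Fin (2 ^ w) → Bool) → List Symbol) (suffix : (Fin w → Bool) → ℤ → List Symbol)
    (encoding≡ : ∀ on X ξ → Instance.encoding (inst on X ξ) ≡ prefix on ++ suffix X ξ)
    (negative : ∀ on X → ¬ VertexCover (Instance.graph (inst on X -[1+ 0 ])) (Instance.ξ (inst on X -[1+ 0 ])))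
    (budget : (Fin w → Bool) → ℕ)
    (cover-> : ∀ {on} x → T (on x) →
       ¬ VertexCover (Instance.graph (inst on (mem x) (+ budget (mem x)))) (Instance.ξ (inst on (mem x) (+ budget (mem x)))))
    (cover-≤ : ∀ {on X} → (∀ x → T (on x) → ∃[ i ] T (X i) × ¬ T (mem x i)) →
       VertexCover (Instance.graph (inst on X (+ budget X))) (Instance.ξ (inst on X (+ budget X))))
    where

    open Crossing M

    weight : (Fin w → Bool) → ℕ
    weight X = sum (bit ∘ X)

    none : Fin w → Bool
    none _ = false

    layer : (Fin (2 ^ w) → Fin 2) → Fin (suc w) → Fin (2 ^ w) → Bool
    layer I j x = isOne (I x) ∧ ⌊ weight (mem x) ℕ.≟ toℕ j ⌋

    layer⁻ : ∀ {I j x} → T (layer I j x) → T (isOne (I x)) × weight (mem x) ≡ toℕ j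
    layer⁻ {I} {j} {x} t = let a , b = Equivalence.to (T-∧ {isOne (I x)}) t in
      a , toWitness {a? = weight (mem x) ℕ.≟ toℕ j} b

    layer⁺ : ∀ {I j x} → T (isOne (I x)) → weight (mem x) ≡ toℕ j → T (layer I j x)
    layer⁺ {I} {j} {x} a e = Equivalence.from (T-∧ {isOne (I x)})
      (a , fromWitness {a? = weight (mem x) ℕ.≟ toℕ j} e)

    answers : ∀ on X ξ {b} → Answers M (Instance.encoding (inst on X ξ)) b → Answers M (prefix on ++ suffix X ξ) b
    answers on X ξ {b} = subst (λ w → Answers M w b) (encoding≡ on X ξ)

    answers-no : ∀ {I j} x → T (isOne (I x)) → weight (mem x) ≡ toℕ j →
                 Answers M (prefix (layer I j) ++ suffix (mem x) (+ budget (mem x))) false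
    answers-no {I} {j} x one e = answers (layer I j) (mem x) _
      (proj₂ (solves (inst (layer I j) (mem x) _)) (cover-> x (layer⁺ {I} one e)))

    -- Were no element of x missing from some y of the layer, x would be included in y; having equal
    -- weight they would coincide, and x would belong to the family.
    answers-yes : ∀ {I j} x → ¬ T (isOne (I x)) → weight (mem x) ≡ toℕ j →
                  Answers M (prefix (layer I j) ++ suffix (mem x) (+ budget (mem x))) true
    answers-yes {I} {j} x ¬one e = answers (layer I j) (mem x) _
      (proj₁ (solves (inst (layer I j) (mem x) _)) (cover-≤ open-column))
      where
      open-column : ∀ y → T (layer I j y) → ∃[ i ] T (mem x i) × ¬ T (mem y i)
      open-column y t with any? (λ i → T? (mem x i) ×-dec ¬? (T? (mem y i)))
      ... | yes r = r
      ... | no ¬r = contradiction (subst (T ∘ isOne ∘ I) y≡x (proj₁ (layer⁻ {I} t))) ¬one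
        where
        x⊆y : ∀ i → T (mem x i) → T (mem y i)
        x⊆y i a = decidable-stable (T? (mem y i)) λ n → ¬r (i , a , n)

        y≡x : y ≡ x
        y≡x = mem-injective (equal-sums (mem x) (mem y) x⊆y (trans e (sym (proj₂ (layer⁻ {I} t))))) x⊆y

    run : ∀ I j → ∃[ o ] ∀ v → Leads (initial M (prefix (layer I j) ++ v)) v o
    -- Some halting run through the prefix is wanted. Threshold -1 gives a no-instance outright,
    -- whatever the graph, so `solves` provides one without the vertex cover problem having to be
    -- decided.
    run I j with answers (layer I j) none -[1+ 0 ] (proj₂ (solves (inst (layer I j) none -[1+ 0 ])) (negative (layer I j) none))
    ... | c , r , h = crossing (prefix (layer I j)) zero (tape [] zero []) r h

    -- Otherwise the question x would be answered no after the prefix of `I` and yes after that of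
    -- `J`, although both prefixes have the same outcome.
    determined : ∀ {I J j} → proj₁ (run I j) ≡ proj₁ (run J j) → ∀ x → weight (mem x) ≡ toℕ j →
                 T (isOne (I x)) → T (isOne (J x))
    determined {I} {J} {j} e x wt one = decidable-stable (T? (isOne (J x))) λ ¬one →
      contradiction
        (answers-unique (answers-yes {J} x ¬one wt)
          (same-outcome (proj₁ (run J j)) (subst (Leads _ _) e (proj₂ (run I j) _)) (proj₂ (run J j) _)
            (answers-no {I} x one wt)))
        λ ()

    module _ (s : ℕ) (bounded : ∀ on X ξ c → Reachable M (Instance.encoding (inst on X ξ)) c → space M c ≤ s) where
      open Code s

      fits : ∀ I j → Fits (proj₁ (run I j))
      fits I j with run I j
      ... | inj₁ _       , _ = z≤n
      -- The configuration at the cut is reached before any suffix; `none` and threshold 0 are an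
      -- arbitrary choice.
      ... | inj₂ (q , t) , L = bounded (layer I j) none (+ 0) (config q _ t)
        (subst (λ u → Reachable M u (config q (suffix none (+ 0)) t)) (sym (encoding≡ (layer I j) none (+ 0))) (L _))

      -- A family is recovered from its `1 + w` outcomes, one for each layer: the outcome for the
      -- weight of x reveals whether x is a member.
      outcomes-≥ : 2 ^ (2 ^ w) ≤ outcomes ^ suc w
      outcomes-≥ = functions-≤ (λ I j → code (proj₁ (run I j))) λ I J e x →
        let j    = fromℕ< (s≤s (sum-bit-≤ (mem x)))
            wt   = sym (toℕ-fromℕ< (s≤s (sum-bit-≤ (mem x))))
            same = code-injective _ _ (fits I j) (fits J j) (e j)
        in isOne-injective (determined {I} {J} same x wt) (determined {J} {I} (sym same) x wt)

-- The growth estimates in natural numbers.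

module Inequalities where
  open import Data.Nat.Base using (_+_; _*_; _^_; _∸_; _≤_; _<_)
  open ℕ.≤-Reasoning
  open +-*-Solver

  n<2^n : ∀ n → n < 2 ^ n
  n<2^n zero    = s≤s z≤n
  n<2^n (suc n) = begin-strict
    suc n           <⟨ s≤s (n<2^n n) ⟩
    suc (2 ^ n)     ≤⟨ ℕ.+-monoˡ-≤ (2 ^ n) (ℕ.m^n>0 2 n) ⟩
    2 ^ n + 2 ^ n   ≡⟨ cong (ℕ._+_ (2 ^ n)) (sym (ℕ.+-identityʳ (2 ^ n))) ⟩
    2 ^ suc n       ∎

  ^-cancelʳ-≤ : ∀ {m n} → 2 ^ m ≤ 2 ^ n → m ≤ n
  ^-cancelʳ-≤ {m} {n} h = ℕ.≮⇒≥ λ n<m → ℕ.<⇒≱ (ℕ.^-monoʳ-< 2 (s≤s (s≤s z≤n)) n<m) h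

  ^-distribʳ-* : ∀ n a b → (a * b) ^ n ≡ a ^ n * b ^ n
  ^-distribʳ-* zero    a b = refl
  ^-distribʳ-* (suc n) a b = trans (cong (a * b *_) (^-distribʳ-* n a b))
    (solve 4 (λ a b x y → a :* b :* (x :* y) := a :* x :* (b :* y)) refl a b (a ^ n) (b ^ n))

  -- Bernoulli's inequality, multiplied by u ^ (1 + n).
  bernoulli : ∀ u n → u ^ n * (u + n) ≤ u * suc u ^ n
  bernoulli u zero    = ℕ.≤-reflexive (solve 1 (λ u → con 1 :* (u :+ con 0) := u :* con 1) refl u)
  bernoulli u (suc n) = begin
    u * u ^ n * (u + suc n)
      ≤⟨ ℕ.m≤m+n _ (u ^ n * n) ⟩
    u * u ^ n * (u + suc n) + u ^ n * n
      ≡⟨ solve 3 (λ u n x → u :* x :* (u :+ (con 1 :+ n)) :+ x :* n := (con 1 :+ u) :* (x :* (u :+ n))) refl u n (u ^ n) ⟩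
    suc u * (u ^ n * (u + n))
      ≤⟨ ℕ.*-monoʳ-≤ (suc u) (bernoulli u n) ⟩
    suc u * (u * suc u ^ n)
      ≡⟨ solve 2 (λ u y → (con 1 :+ u) :* (u :* y) := u :* ((con 1 :+ u) :* y)) refl u (suc u ^ n) ⟩
    u * suc u ^ suc n ∎

  -- (1 + 1/u)^u is at least 2, by Bernoulli with n = u.
  double : ∀ u .{{_ : NonZero u}} → 2 * u ^ u ≤ suc u ^ u
  double u = ℕ.*-cancelˡ-≤ u (begin
    u * (2 * u ^ u)  ≡⟨ solve 2 (λ u x → u :* (con 2 :* x) := x :* (u :+ u)) refl u (u ^ u) ⟩
    u ^ u * (u + u)  ≤⟨ bernoulli u u ⟩
    u * suc u ^ u    ∎)

  -- Each block of `u` factors 1 + 1/u gains a factor of two, and the factors left over lose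
  -- nothing.
  grow : ∀ u n .{{_ : NonZero u}} r → u * n ≤ r → 2 ^ n * u ^ r ≤ suc u ^ r
  grow u n r h = begin
    2 ^ n * u ^ r                               ≡⟨ cong (λ r → 2 ^ n * u ^ r) (sym (ℕ.m+[n∸m]≡n h)) ⟩
    2 ^ n * u ^ (u * n + t)                     ≡⟨ cong (2 ^ n *_) (ℕ.^-distribˡ-+-* u (u * n) t) ⟩
    2 ^ n * (u ^ (u * n) * u ^ t)               ≡⟨ cong (λ x → 2 ^ n * (x * u ^ t)) (sym (ℕ.^-*-assoc u u n)) ⟩
    2 ^ n * ((u ^ u) ^ n * u ^ t)               ≡⟨ sym (ℕ.*-assoc (2 ^ n) _ _) ⟩
    2 ^ n * (u ^ u) ^ n * u ^ t                 ≡⟨ cong (_* u ^ t) (sym (^-distribʳ-* n 2 (u ^ u))) ⟩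
    (2 * u ^ u) ^ n * u ^ t                     ≤⟨ ℕ.*-mono-≤ (ℕ.^-monoˡ-≤ n (double u)) (ℕ.^-monoˡ-≤ t (ℕ.n≤1+n u)) ⟩
    (suc u ^ u) ^ n * suc u ^ t                 ≡⟨ cong (_* suc u ^ t) (ℕ.^-*-assoc (suc u) u n) ⟩
    suc u ^ (u * n) * suc u ^ t                 ≡⟨ sym (ℕ.^-distribˡ-+-* (suc u) (u * n) t) ⟩
    suc u ^ (u * n + t)                         ≡⟨ cong (suc u ^_) (ℕ.m+[n∸m]≡n h) ⟩
    suc u ^ r                                   ∎
    where
    t = r ∸ u * n

  -- The base of the space bound is u/d, at least 1 and below 2; `C` is the constant of that bound
  -- and `c` a constant of the machine.
  module Asymptotics (u d c C : ℕ) (d≥1 : 1 ≤ d) (d≤u : d ≤ u) (u<2d : u < 2 * d) where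

    private instance
      d≢0 : NonZero d
      d≢0 = >-nonZero d≥1

      u≢0 : NonZero u
      u≢0 = >-nonZero (ℕ.≤-trans d≥1 d≤u)

    module _ (q : ℕ) (q≥1 : 1 ≤ q) (q≥9u : u * 9 ≤ q) (q≥cC : c * suc C ≤ q) where

      D : ℕ
      D = q * q + (q + suc q)

      square : D ≡ suc q * suc q
      square = solve 1 (λ q → q :* q :+ (q :+ (con 1 :+ q)) := (con 1 :+ q) :* (con 1 :+ q)) refl q

      D≤ : D ≤ 2 ^ q * 2 ^ q
      D≤ = ℕ.≤-trans (ℕ.≤-reflexive square) (ℕ.*-mono-≤ (n<2^n q) (n<2^n q))

      D*D≤ : D * D ≤ 2 ^ (4 * q)
      D*D≤ = begin
        D * D                                  ≤⟨ ℕ.*-mono-≤ D≤ D≤ ⟩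
        2 ^ q * 2 ^ q * (2 ^ q * 2 ^ q)        ≡⟨ solve 1 (λ x → x :* x :* (x :* x) := x :^ 4) refl (2 ^ q) ⟩
        (2 ^ q) ^ 4                            ≡⟨ ℕ.^-*-assoc 2 q 4 ⟩
        2 ^ (q * 4)                            ≡⟨ cong (2 ^_) (ℕ.*-comm q 4) ⟩
        2 ^ (4 * q)                            ∎

      -- The factor c (1 + C) D² collects everything polynomial. It is at most 2^(5q): `c * suc C`
      -- is at most q, hence at most 2^q, and D = (1 + q)² is at most 4^q.
      large : ∀ s L → s * d ^ D ≤ C * (u ^ D * L) → L ≤ D → 2 ^ (q * q) ≤ c * (suc s * suc (q * q)) →
              2 ^ (q * q) * d ^ D ≤ 2 ^ (5 * q) * u ^ D
      large s L h L≤D b = begin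
        2 ^ (q * q) * d ^ D
          ≤⟨ ℕ.*-monoˡ-≤ (d ^ D) b ⟩
        c * (suc s * suc (q * q)) * d ^ D
          ≡⟨ solve 4 (λ c s w x → c :* ((con 1 :+ s) :* w) :* x := c :* w :* (s :* x :+ x)) refl c s (suc (q * q)) (d ^ D) ⟩
        c * suc (q * q) * (s * d ^ D + d ^ D)
          ≤⟨ ℕ.*-mono-≤ (ℕ.*-monoʳ-≤ c w<D) (ℕ.+-mono-≤ (ℕ.≤-trans h (ℕ.*-monoʳ-≤ C (ℕ.*-monoʳ-≤ (u ^ D) L≤D))) d^D≤) ⟩
        c * D * (C * (u ^ D * D) + u ^ D * D)
          ≡⟨ solve 4 (λ c C D x → c :* D :* (C :* (x :* D) :+ x :* D) := c :* (con 1 :+ C) :* (D :* D) :* x) refl c C D (u ^ D) ⟩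
        c * suc C * (D * D) * u ^ D
          ≤⟨ ℕ.*-monoˡ-≤ (u ^ D) (ℕ.*-mono-≤ (ℕ.≤-trans q≥cC (ℕ.<⇒≤ (n<2^n q))) D*D≤) ⟩
        2 ^ q * 2 ^ (4 * q) * u ^ D
          ≡⟨ cong (_* u ^ D) (sym (ℕ.^-distribˡ-+-* 2 q (4 * q))) ⟩
        2 ^ (5 * q) * u ^ D ∎
        where
        w<D : suc (q * q) ≤ D
        w<D = ℕ.≤-trans (ℕ.≤-reflexive (ℕ.+-comm 1 (q * q))) (ℕ.+-monoʳ-≤ (q * q) (ℕ.≤-trans (s≤s z≤n) (ℕ.m≤n+m (suc q) q)))

        d^D≤ : d ^ D ≤ u ^ D * D
        d^D≤ = ℕ.≤-trans (ℕ.^-monoˡ-≤ D d≤u) (ℕ.≤-trans (ℕ.≤-reflexive (sym (ℕ.*-identityʳ (u ^ D))))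
          (ℕ.*-monoʳ-≤ (u ^ D) (ℕ.≤-trans (s≤s z≤n) w<D)))

      -- The 2q + 1 levels beyond the boundary are estimated by base 2, which raises 2^(5q) to 2^(7q
      -- + 1), less than 2^(9q). This is recovered from the q² boundary levels: in each of q blocks
      -- of length q, replacing u by u + 1, at most 2d, gains 2^9 because q is at least 9u.
      small : 2 ^ (5 * q) * u ^ D < 2 ^ (q * q) * d ^ D
      small = begin-strict
        2 ^ (5 * q) * u ^ D
          ≡⟨ cong (2 ^ (5 * q) *_) (ℕ.^-distribˡ-+-* u (q * q) (q + suc q)) ⟩
        2 ^ (5 * q) * (u ^ (q * q) * u ^ e)
          ≤⟨ ℕ.*-monoʳ-≤ (2 ^ (5 * q)) (ℕ.*-monoʳ-≤ (u ^ (q * q)) (ℕ.^-monoˡ-≤ e (ℕ.<⇒≤ u<2d))) ⟩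
        2 ^ (5 * q) * (u ^ (q * q) * (2 * d) ^ e)
          ≡⟨ cong (λ x → 2 ^ (5 * q) * (u ^ (q * q) * x)) (^-distribʳ-* e 2 d) ⟩
        2 ^ (5 * q) * (u ^ (q * q) * (2 ^ e * d ^ e))
          ≡⟨ solve 4 (λ a b c d → a :* (b :* (c :* d)) := a :* c :* b :* d) refl (2 ^ (5 * q)) (u ^ (q * q)) (2 ^ e) (d ^ e) ⟩
        2 ^ (5 * q) * 2 ^ e * u ^ (q * q) * d ^ e
          ≡⟨ cong (λ x → x * u ^ (q * q) * d ^ e) (sym (ℕ.^-distribˡ-+-* 2 (5 * q) e)) ⟩
        2 ^ (5 * q + e) * u ^ (q * q) * d ^ e
          <⟨ ℕ.*-monoˡ-< (d ^ e) {{ℕ.m^n≢0 d e}} (ℕ.*-monoˡ-< (u ^ (q * q)) {{ℕ.m^n≢0 u (q * q)}} (ℕ.^-monoʳ-< 2 (s≤s (s≤s z≤n)) exponents)) ⟩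
        2 ^ (9 * q) * u ^ (q * q) * d ^ e
          ≡⟨ cong₂ (λ x y → x * y * d ^ e) (sym (ℕ.^-*-assoc 2 9 q)) (sym (ℕ.^-*-assoc u q q)) ⟩
        (2 ^ 9) ^ q * (u ^ q) ^ q * d ^ e
          ≡⟨ cong (_* d ^ e) (sym (^-distribʳ-* q (2 ^ 9) (u ^ q))) ⟩
        (2 ^ 9 * u ^ q) ^ q * d ^ e
          ≤⟨ ℕ.*-monoˡ-≤ (d ^ e) (ℕ.^-monoˡ-≤ q (ℕ.≤-trans (grow u 9 q q≥9u) (ℕ.^-monoˡ-≤ q u<2d))) ⟩
        ((2 * d) ^ q) ^ q * d ^ e
          ≡⟨ cong (_* d ^ e) (trans (ℕ.^-*-assoc (2 * d) q q) (^-distribʳ-* (q * q) 2 d)) ⟩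
        2 ^ (q * q) * d ^ (q * q) * d ^ e
          ≡⟨ ℕ.*-assoc (2 ^ (q * q)) _ _ ⟩
        2 ^ (q * q) * (d ^ (q * q) * d ^ e)
          ≡⟨ cong (2 ^ (q * q) *_) (sym (ℕ.^-distribˡ-+-* d (q * q) e)) ⟩
        2 ^ (q * q) * d ^ D ∎
        where
        e = q + suc q

        exponents : 5 * q + e < 9 * q
        exponents = begin-strict
          5 * q + e       ≡⟨ solve 1 (λ q → con 5 :* q :+ (q :+ (con 1 :+ q)) := con 1 :+ con 7 :* q) refl q ⟩
          1 + 7 * q       ≤⟨ ℕ.+-monoˡ-≤ (7 * q) q≥1 ⟩
          q + 7 * q       <⟨ ℕ.m<n+m (q + 7 * q) q≥1 ⟩
          q + (q + 7 * q) ≡⟨ refl ⟩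
          9 * q           ∎

      too-small : ∀ s L → s * d ^ D ≤ C * (u ^ D * L) → L ≤ D → ¬ 2 ^ (q * q) ≤ c * (suc s * suc (q * q))
      too-small s L h L≤D b = ℕ.<⇒≱ small (large s L h L≤D b)

      -- Holds since u/d is at least 1. It carries the bound from width D - 1 of trees and paths to
      -- the exponent D.
      raise : ∀ s L k → s * d ^ k ≤ C * (u ^ k * L) → s * d ^ suc k ≤ C * (u ^ suc k * L)
      raise s L k h = begin
        s * (d * d ^ k)        ≡⟨ solve 3 (λ s d x → s :* (d :* x) := d :* (s :* x)) refl s d (d ^ k) ⟩
        d * (s * d ^ k)        ≤⟨ ℕ.*-mono-≤ d≤u h ⟩
        u * (C * (u ^ k * L))  ≡⟨ solve 4 (λ u C x L → u :* (C :* (x :* L)) := C :* (u :* x :* L)) refl u C (u ^ k) L ⟩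
        C * (u * u ^ k * L)    ∎

  -- A crude bound, from n < 2^n for the bases: the logarithm of the number of outcomes is linear in
  -- the space, with a factor that depends on the machine only.
  outcomes-≤ : ∀ Q G H .{{_ : NonZero H}} s →
               2 + Q * (G * (H ^ s * H ^ s)) ≤ 2 ^ ((2 + Q * G + 2 * H) * suc s)
  outcomes-≤ Q G H s = begin
    2 + Q * (G * P)
      ≤⟨ ℕ.+-monoˡ-≤ (Q * (G * P)) (ℕ.*-monoʳ-≤ 2 (ℕ.*-mono-≤ (ℕ.m^n>0 H s) (ℕ.m^n>0 H s))) ⟩
    2 * P + Q * (G * P)
      ≡⟨ solve 3 (λ Q G P → con 2 :* P :+ Q :* (G :* P) := (con 2 :+ Q :* G) :* P) refl Q G P ⟩
    (2 + Q * G) * P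
      ≤⟨ ℕ.*-mono-≤ (ℕ.<⇒≤ (n<2^n (2 + Q * G))) (ℕ.*-mono-≤ H^s≤ H^s≤) ⟩
    2 ^ (2 + Q * G) * (2 ^ (H * s) * 2 ^ (H * s))
      ≡⟨ cong (2 ^ (2 + Q * G) *_) (sym (ℕ.^-distribˡ-+-* 2 (H * s) (H * s))) ⟩
    2 ^ (2 + Q * G) * 2 ^ (H * s + H * s)
      ≡⟨ sym (ℕ.^-distribˡ-+-* 2 (2 + Q * G) (H * s + H * s)) ⟩
    2 ^ (2 + Q * G + (H * s + H * s))
      ≤⟨ ℕ.^-monoʳ-≤ 2 (ℕ.m≤m+n (2 + Q * G + (H * s + H * s)) (2 * H + (2 + Q * G) * s)) ⟩
    2 ^ (2 + Q * G + (H * s + H * s) + (2 * H + (2 + Q * G) * s))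
      ≡⟨ cong (2 ^_) (solve 3 (λ X H s → X :+ (H :* s :+ H :* s) :+ (con 2 :* H :+ X :* s)
           := (X :+ con 2 :* H) :* (con 1 :+ s)) refl (2 + Q * G) H s) ⟩
    2 ^ ((2 + Q * G + 2 * H) * suc s) ∎
    where
    P = H ^ s * H ^ s

    H^s≤ : H ^ s ≤ 2 ^ (H * s)
    H^s≤ = ℕ.≤-trans (ℕ.^-monoˡ-≤ s (ℕ.<⇒≤ (n<2^n H))) (ℕ.≤-reflexive (ℕ.^-*-assoc 2 H s))

open Discrete
open Inequalities

-- The size of the graphs, and the family of instances for each q.

length-concatMap : ∀ {A B : Set} (F : B → List A) {c} → (∀ x → length (F x) ≡ c) → ∀ xs →
                   length (concatMap F xs) ≡ length xs ℕ.* c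
length-concatMap F e []       = refl
length-concatMap F e (x ∷ xs) = trans (length-++ (F x)) (cong₂ ℕ._+_ (e x) (length-concatMap F e xs))

module Order (p N : ℕ) (mem : Fin N → Fin (suc p ℕ.* suc p) → Bool) (x₀ : Fin N) where
  open Gadgets p N mem
  open Construction p N mem x₀

  length-map-allFin : ∀ {m} (f : Fin m → V) → length (map f (allFin m)) ≡ m
  length-map-allFin f = trans (length-map f (allFin _)) (length-tabulate id)

  length-concatMap-allFin : ∀ {m} (F : Fin m → List V) {c} → (∀ x → length (F x) ≡ c) →
                            length (concatMap F (allFin m)) ≡ m ℕ.* c
  length-concatMap-allFin {m} F {c} e = trans (length-concatMap F e (allFin m)) (cong (ℕ._* c) (length-tabulate {n = m} id))

  order≡ : order ≡ suc p ℕ.* suc p ℕ.+ (N ℕ.* (suc p ℕ.+ suc p ℕ.* suc (suc p)) ℕ.+ suc p ℕ.* suc p ℕ.* 1)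
  order≡ = trans (length-++ boundary) (cong₂ ℕ._+_ (length-map-allFin bd)
    (trans (length-++ (concatMap gadget-of (allFin N))) (cong₂ ℕ._+_
      (length-concatMap-allFin gadget-of λ x → trans (length-++ (map (hub x) (allFin (suc p))))
        (cong₂ ℕ._+_ (length-map-allFin (hub x)) (length-concatMap-allFin (cells-of x) λ r → length-map-allFin (cell x r))))
      (length-concatMap-allFin (λ i → ask i ∷ []) λ _ → refl))))

  order-≥ : suc p ℕ.≤ order
  order-≥ = ℕ.≤-trans (ℕ.m≤m*n (suc p) (suc p)) (ℕ.≤-trans (ℕ.m≤m+n _ _) (ℕ.≤-reflexive (sym order≡)))

  order-≤ : suc p ℕ.* suc p ℕ.≤ N → order ℕ.≤ N ℕ.* (2 ℕ.* (suc (suc p) ℕ.* suc (suc p)))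
  order-≤ h = begin
    order
      ≡⟨ order≡ ⟩
    w ℕ.+ (N ℕ.* (q ℕ.+ q ℕ.* suc q) ℕ.+ w ℕ.* 1)
      ≤⟨ ℕ.+-mono-≤ h (ℕ.+-monoʳ-≤ (N ℕ.* (q ℕ.+ q ℕ.* suc q)) (ℕ.*-monoˡ-≤ 1 h)) ⟩
    N ℕ.+ (N ℕ.* (q ℕ.+ q ℕ.* suc q) ℕ.+ N ℕ.* 1)
      ≤⟨ ℕ.m≤m+n _ (N ℕ.* (q ℕ.* q ℕ.+ 2 ℕ.* q)) ⟩
    N ℕ.+ (N ℕ.* (q ℕ.+ q ℕ.* suc q) ℕ.+ N ℕ.* 1) ℕ.+ N ℕ.* (q ℕ.* q ℕ.+ 2 ℕ.* q)
      ≡⟨ solve 2 (λ N q → N :+ (N :* (q :+ q :* (con 1 :+ q)) :+ N :* con 1) :+ N :* (q :* q :+ con 2 :* q)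
           := N :* (con 2 :* ((con 1 :+ q) :* (con 1 :+ q)))) refl N q ⟩
    N ℕ.* (2 ℕ.* (suc q ℕ.* suc q)) ∎
    where
    open ℕ.≤-Reasoning
    open +-*-Solver
    q = suc p
    w = q ℕ.* q

-- The side length minus one, chosen such that the width or depth is odd: a negative
-- base 2 - ε is refuted only at odd exponents.

choose : Kind → ℕ → ℕ
choose tree      m = m ℕ.+ m
choose path      m = m ℕ.+ m
choose treedepth m = suc (m ℕ.+ m)

choose-≥ : ∀ κ m → m ℕ.≤ suc (choose κ m)
choose-≥ tree      m = ℕ.m≤n⇒m≤1+n (ℕ.m≤m+n m m)
choose-≥ path      m = ℕ.m≤n⇒m≤1+n (ℕ.m≤m+n m m)
choose-≥ treedepth m = ℕ.m≤n⇒m≤1+n (ℕ.m≤n⇒m≤1+n (ℕ.m≤m+n m m))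

exponent : DPTM → ℕ
exponent M = 2 ℕ.+ suc (DPTM.states M) ℕ.* suc (DPTM.symbols M) ℕ.+ 2 ℕ.* suc (suc (DPTM.symbols M))

breadth : Kind → ℕ → ℕ
breadth tree      q = q ℕ.* q ℕ.+ (q ℕ.+ q)
breadth path      q = q ℕ.* q ℕ.+ (q ℕ.+ q)
breadth treedepth q = q ℕ.* q ℕ.+ (q ℕ.+ suc q)

suc-breadth : ∀ q → suc (q ℕ.* q ℕ.+ (q ℕ.+ q)) ≡ q ℕ.* q ℕ.+ (q ℕ.+ suc q)
suc-breadth = solve 1 (λ q → con 1 :+ (q :* q :+ (q :+ q)) := q :* q :+ (q :+ (con 1 :+ q))) refl
  where open +-*-Solver

breadth-≥ : ∀ κ q → q ℕ.≤ breadth κ q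
breadth-≥ tree      q = ℕ.≤-trans (ℕ.m≤m+n q q) (ℕ.m≤n+m (q ℕ.+ q) (q ℕ.* q))
breadth-≥ path      q = ℕ.≤-trans (ℕ.m≤m+n q q) (ℕ.m≤n+m (q ℕ.+ q) (q ℕ.* q))
breadth-≥ treedepth q = ℕ.≤-trans (ℕ.m≤m+n q (suc q)) (ℕ.m≤n+m (q ℕ.+ suc q) (q ℕ.* q))

-- For treedepth the breadth is (1 + q)², odd for the even q chosen there; for trees and paths it is
-- one less, odd for odd q.
breadth-odd : ∀ κ m → ∃[ e ] breadth κ (suc (choose κ m)) ≡ suc (e ℕ.+ e)
breadth-odd tree m = 2 ℕ.* (m ℕ.* m) ℕ.+ 4 ℕ.* m ℕ.+ 1 ,
  solve 1 (λ m → let q = con 1 :+ (m :+ m) ; e = con 2 :* (m :* m) :+ con 4 :* m :+ con 1 in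
    q :* q :+ (q :+ q) := con 1 :+ (e :+ e)) refl m
  where open +-*-Solver
breadth-odd path m = breadth-odd tree m
breadth-odd treedepth m = 2 ℕ.* (m ℕ.* m) ℕ.+ 6 ℕ.* m ℕ.+ 4 ,
  solve 1 (λ m → let q = con 2 :+ (m :+ m) ; e = con 2 :* (m :* m) :+ con 6 :* m :+ con 4 in
    q :* q :+ (q :+ (con 1 :+ q)) := con 1 :+ (e :+ e)) refl m
  where open +-*-Solver

-- All members share `k` and `n`, so that the assumed space bound becomes a single number `s` to
-- which `counted` applies.
record Family (κ : Kind) (M : DPTM) (q : ℕ) : Set₁ where
  field
    Index    : Set
    some     : Index
    instance-at : Index → Instance κ
    k n      : ℕ
    k≡       : ∀ i → Instance.k (instance-at i) ≡ k
    n≡       : ∀ i → Instance.n (instance-at i) ≡ n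
    k-breadth : k ≡ breadth κ q
    n-≥      : q ℕ.≤ n
    log-n    : ⌈log₂ n ⌉ ℕ.≤ q ℕ.* q ℕ.+ (q ℕ.+ suc q)
    counted  : ∀ s → (∀ i c → Reachable M (Instance.encoding (instance-at i)) c → space M c ℕ.≤ s) →
               2 ℕ.^ (q ℕ.* q) ℕ.≤ exponent M ℕ.* (suc s ℕ.* suc (q ℕ.* q))

no-negative-cover : ∀ G → ¬ VertexCover G -[1+ 0 ]
no-negative-cover G (_ , _ , ())

module _ (κ : Kind) (M : DPTM) (solves : Solves VertexCover κ M) (p : ℕ) where

  private
    w N : ℕ
    w = suc p ℕ.* suc p
    N = 2 ℕ.^ w

    x₀ : Fin N
    x₀ = funToFin {w} λ _ → zero

    open Gadgets p N mem using (budget)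
    open Construction p N mem x₀
    open Instances p N mem x₀
    open Layout′ using (inst; prefix; suffix; encoding≡; parameter; width≡; size≡)
    open Order p N mem x₀

    -- The right side is the depth itself: with `q = 1 + p` there are at most 2^w * 2 (1 + q)²
    -- vertices, and 1 + q is at most 2^q.
    log-order : ⌈log₂ order ⌉ ℕ.≤ w ℕ.+ (suc p ℕ.+ suc (suc p))
    log-order = ℕ.≤-trans (⌈log₂⌉-mono-≤ (begin
      order
        ≤⟨ order-≤ (ℕ.<⇒≤ (n<2^n w)) ⟩
      2 ℕ.^ w ℕ.* (2 ℕ.* (suc (suc p) ℕ.* suc (suc p)))
        ≤⟨ ℕ.*-monoʳ-≤ (2 ℕ.^ w) (ℕ.*-monoʳ-≤ 2 (ℕ.*-mono-≤ (n<2^n (suc p)) (n<2^n (suc p)))) ⟩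
      2 ℕ.^ w ℕ.* (2 ℕ.* (2 ℕ.^ suc p ℕ.* 2 ℕ.^ suc p))
        ≡⟨ cong (2 ℕ.^ w ℕ.*_) (trans (solve 1 (λ x → con 2 :* (x :* x) := x :* (con 2 :* x)) refl (2 ℕ.^ suc p))
             (sym (ℕ.^-distribˡ-+-* 2 (suc p) (suc (suc p))))) ⟩
      2 ℕ.^ w ℕ.* 2 ℕ.^ (suc p ℕ.+ suc (suc p))
        ≡⟨ sym (ℕ.^-distribˡ-+-* 2 w (suc p ℕ.+ suc (suc p))) ⟩
      2 ℕ.^ (w ℕ.+ (suc p ℕ.+ suc (suc p))) ∎))
      (ℕ.≤-reflexive (⌈log₂2^n⌉≡n (w ℕ.+ (suc p ℕ.+ suc (suc p)))))
      where
      open ℕ.≤-Reasoning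
      open +-*-Solver

    parameter-breadth : ∀ κ → parameter κ ≡ breadth κ (suc p)
    parameter-breadth tree      = ℕ.suc-injective (trans height-numbered (sym (suc-breadth (suc p))))
    parameter-breadth path      = ℕ.suc-injective (trans height-numbered (sym (suc-breadth (suc p))))
    parameter-breadth treedepth = height-numbered

  family : Family κ M (suc p)
  family = record
    { Index       = (Fin N → Bool) × (Fin w → Bool) × ℤ
    ; some        = none , none , + 0
    ; instance-at = λ (on , X , ξ) → inst κ on X ξ
    ; k           = parameter κ
    ; n           = order
    ; k≡          = λ (on , X , _) → width≡ κ on X
    ; n≡          = λ (on , X , _) → trans (size≡ κ on X) (trans (cong length labels-numbered) (length-map number vertices))
    ; k-breadth   = parameter-breadth κ
    ; n-≥         = order-≥
    ; log-n       = log-order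
    ; counted     = λ s bounded → ^-cancelʳ-≤ (ℕ.≤-trans (outcomes-≥ s λ on X ξ → bounded (on , X , ξ))
        (ℕ.≤-trans (ℕ.^-monoˡ-≤ (suc w) (outcomes-≤ (suc (DPTM.states M)) (suc (DPTM.symbols M)) (suc (suc (DPTM.symbols M))) s))
          (ℕ.≤-reflexive (trans (ℕ.^-*-assoc 2 (exponent M ℕ.* suc s) (suc w))
            (cong (2 ℕ.^_) (ℕ.*-assoc (exponent M) (suc s) (suc w)))))))
    }
    where
    open Counting w κ M solves (inst κ) (prefix κ) (suffix κ) (encoding≡ κ) (λ on X → no-negative-cover (graph on X)) budget
      (λ x o → cover-> x o λ _ → refl) cover-≤ using (outcomes-≥)

-- Clearing denominators, and the signs of powers.

open import Data.Rational using (ℚ; 0ℚ; 1ℚ; _+_; _-_; _<_)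
open import Data.Rational using (mkℚ; _*_; _≤_; *≤*; toℚᵘ; nonPositive; nonNegative; NonPositive)
open import Algebra.Definitions.RawSemiring ℚ.+-*-rawSemiring using (_^_)

fromℕ≡ : ∀ m → fromℕ m ≡ mkℚ (+ m) 0 (Coprime.sym (Coprime.1-coprimeTo m))
fromℕ≡ m = ℚ.normalize-coprime (Coprime.sym (Coprime.1-coprimeTo m))

toℚᵘ-fromℕ : ∀ m → toℚᵘ (fromℕ m) ≡ mkℚᵘ (+ m) 0
toℚᵘ-fromℕ m = cong toℚᵘ (fromℕ≡ m)

fromℕ-* : ∀ m n → fromℕ (m ℕ.* n) ≡ fromℕ m * fromℕ n
fromℕ-* m n = ℚ.toℚᵘ-injective (ℚᵘ.≃-trans (ℚᵘ.≃-reflexive (toℚᵘ-fromℕ (m ℕ.* n)))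
  (ℚᵘ.≃-trans (ℚᵘ.≃-reflexive (trans (cong (λ i → mkℚᵘ i 0) (ℤ.pos-* m n))
      (sym (cong₂ ℚᵘ._*_ (toℚᵘ-fromℕ m) (toℚᵘ-fromℕ n)))))
    (ℚᵘ.≃-sym (ℚ.toℚᵘ-homo-* (fromℕ m) (fromℕ n)))))

fromℕ-cancel-≤ : ∀ {m n} → fromℕ m ≤ fromℕ n → m ℕ.≤ n
fromℕ-cancel-≤ {m} {n} h rewrite fromℕ≡ m | fromℕ≡ n with *≤* i ← h =
  ℤ.drop‿+≤+ (subst₂ ℤ._≤_ (ℤ.*-identityʳ (+ m)) (ℤ.*-identityʳ (+ n)) i)

fromℕ-≥0 : ∀ m → 0ℚ ≤ fromℕ m
fromℕ-≥0 m rewrite fromℕ≡ m = *≤* (subst (ℤ._≤_ (+ 0)) (sym (ℤ.*-identityʳ (+ m))) (ℤ.+≤+ ℕ.z≤n))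

module _ (u d-1 : ℕ) .(coprime : Coprime.Coprime u (suc d-1)) where

  private
    a = mkℚ (+ u) d-1 coprime
    d = suc d-1

  numerator : a * fromℕ d ≡ fromℕ u
  numerator = ℚ.toℚᵘ-injective (ℚᵘ.≃-trans (ℚ.toℚᵘ-homo-* a (fromℕ d))
    (ℚᵘ.≃-trans (ℚᵘ.≃-reflexive (cong (ℚᵘ._*_ (mkℚᵘ (+ u) d-1)) (toℚᵘ-fromℕ d)))
      (ℚᵘ.≃-trans (*≡* (trans (ℤ.*-identityʳ _) (cong (λ z → + u ℤ.* + z) (sym (ℕ.*-identityʳ d)))))
        (ℚᵘ.≃-reflexive (sym (toℚᵘ-fromℕ u))))))

  numerator-^ : ∀ k → a ^ k * fromℕ (d ℕ.^ k) ≡ fromℕ (u ℕ.^ k)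
  numerator-^ zero    = ℚ.*-identityˡ (fromℕ 1)
  numerator-^ (suc k) = trans (cong (a ^ suc k *_) (fromℕ-* d (d ℕ.^ k)))
    (trans (interchange a (a ^ k) (fromℕ d) (fromℕ (d ℕ.^ k)))
      (trans (cong₂ _*_ numerator (numerator-^ k)) (sym (fromℕ-* u (u ℕ.^ k)))))

  clear : ∀ s C k L → fromℕ s ≤ fromℕ C * (a ^ k * fromℕ L) → s ℕ.* d ℕ.^ k ℕ.≤ C ℕ.* (u ℕ.^ k ℕ.* L)
  clear s C k L h = fromℕ-cancel-≤ (subst₂ _≤_ (sym (fromℕ-* s (d ℕ.^ k))) bound
    (ℚ.*-monoʳ-≤-nonNeg (fromℕ (d ℕ.^ k)) {{nonNegative (fromℕ-≥0 (d ℕ.^ k))}} h))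
    where
    bound : fromℕ C * (a ^ k * fromℕ L) * fromℕ (d ℕ.^ k) ≡ fromℕ (C ℕ.* (u ℕ.^ k ℕ.* L))
    bound = trans (ℚ.*-assoc (fromℕ C) _ _) (trans (cong (fromℕ C *_)
      (trans (xy∙z≈xz∙y (a ^ k) (fromℕ L) (fromℕ (d ℕ.^ k)))
        (trans (cong (_* fromℕ L) (numerator-^ k)) (sym (fromℕ-* (u ℕ.^ k) L)))))
      (sym (fromℕ-* C (u ℕ.^ k ℕ.* L))))

module _ {a : ℚ} (a≤0 : a ≤ 0ℚ) where

  private instance
    _ : NonPositive a
    _ = nonPositive a≤0

  even-power : ∀ e → 0ℚ ≤ a ^ (e ℕ.+ e)
  odd-power : ∀ e → a ^ suc (e ℕ.+ e) ≤ 0ℚ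

  even-power zero    = *≤* (ℤ.+≤+ ℕ.z≤n)
  even-power (suc e) rewrite ℕ.+-suc e e =
    subst (_≤ a * a ^ suc (e ℕ.+ e)) (ℚ.*-zeroʳ a) (ℚ.*-monoˡ-≤-nonPos a (odd-power e))

  odd-power e = subst (a * a ^ (e ℕ.+ e) ≤_) (ℚ.*-zeroʳ a) (ℚ.*-monoˡ-≤-nonPos a (even-power e))

  odd-bound : ∀ s C L e → fromℕ s ≤ fromℕ C * (a ^ suc (e ℕ.+ e) * fromℕ L) → s ℕ.≤ 0
  odd-bound s C L e h = fromℕ-cancel-≤ (ℚ.≤-trans h (subst (fromℕ C * (a ^ suc (e ℕ.+ e) * fromℕ L) ≤_) (ℚ.*-zeroʳ (fromℕ C))
    (ℚ.*-monoˡ-≤-nonNeg (fromℕ C) {{nonNegative (fromℕ-≥0 C)}}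
      (subst (a ^ suc (e ℕ.+ e) * fromℕ L ≤_) (ℚ.*-zeroˡ (fromℕ L))
        (ℚ.*-monoʳ-≤-nonNeg (fromℕ L) {{nonNegative (fromℕ-≥0 L)}} (odd-power e))))))

-- Refuting the space bound for negative and for nonnegative bases.

quotient-bound : ∀ {m o n} .{{_ : NonZero n}} → m ℕ.* n ℕ.≤ o → m ℕ.≤ o / n
quotient-bound {m} {o} {n} h = ℕ.≤-trans (ℕ.≤-reflexive (sym (m*n/n≡m m n))) (/-monoˡ-≤ n h)

module _ (κ : Kind) (M : DPTM) {q : ℕ} (F : Family κ M q) (C : ℕ) where
  open Family F

  L : ℕ
  L = ⌈log₂ n ⌉

  module _ (a : ℚ) (bound : ∀ i c → Reachable M (Instance.encoding (instance-at i)) c →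
                            fromℕ (space M c) ≤ fromℕ C * (a ^ k * fromℕ L)) where

    -- At an odd exponent the bound is at most zero, while even the initial tape has one cell.
    negative-contradiction : a ≤ 0ℚ → ¬ (∃[ e ] breadth κ q ≡ suc (e ℕ.+ e))
    negative-contradiction a≤0 (e , odd) = contradiction
      (odd-bound a≤0 1 C L e (subst (λ k → fromℕ 1 ≤ fromℕ C * (a ^ k * fromℕ L)) (trans k-breadth odd)
        (bound some (initial M (Instance.encoding (instance-at some))) Star.ε)))
      λ ()

  module _ (u₀ d-1 : ℕ) .(coprime : Coprime.Coprime u₀ (suc d-1))
           (bound : ∀ i c → Reachable M (Instance.encoding (instance-at i)) c →
                    fromℕ (space M c) ≤ fromℕ C * (mkℚ (+ u₀) d-1 coprime ^ k * fromℕ L)) where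

    private
      d u : ℕ
      d = suc d-1
      -- A base below one is raised to one: this weakens the bound and secures d ≤ u.
      u = u₀ ⊔ d

      s : ℕ
      s = (C ℕ.* (u ℕ.^ k ℕ.* L)) / d ℕ.^ k
        where instance _ = ℕ.m^n≢0 d k

    space-≤ : ∀ i c → Reachable M (Instance.encoding (instance-at i)) c → space M c ℕ.≤ s
    space-≤ i c r = quotient-bound {{ℕ.m^n≢0 d k}} (ℕ.≤-trans (clear u₀ d-1 coprime (space M c) C k L (bound i c r))
      (ℕ.*-monoʳ-≤ C (ℕ.*-monoˡ-≤ L (ℕ.^-monoˡ-≤ k (ℕ.m≤m⊔n u₀ d)))))

    s-≤ : s ℕ.* d ℕ.^ k ℕ.≤ C ℕ.* (u ℕ.^ k ℕ.* L)
    s-≤ = m/n*n≤m (C ℕ.* (u ℕ.^ k ℕ.* L)) (d ℕ.^ k) {{ℕ.m^n≢0 d k}}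

    nonnegative-contradiction : u₀ ℕ.< 2 ℕ.* d → 1 ℕ.≤ q → u ℕ.* 9 ℕ.≤ q → ¬ exponent M ℕ.* suc C ℕ.≤ q
    nonnegative-contradiction u₀<2d q≥1 q≥9u q≥cC = too-small q q≥1 q≥9u q≥cC s L (at-depth κ k-breadth s-≤) log-n (counted s space-≤)
      where
      open Asymptotics u d (exponent M) C (s≤s z≤n) (ℕ.m≤n⊔m u₀ d)
        (ℕ.⊔-lub u₀<2d (ℕ.m<m+n d (s≤s z≤n)))

      at-depth : ∀ κ → k ≡ breadth κ q → s ℕ.* d ℕ.^ k ℕ.≤ C ℕ.* (u ℕ.^ k ℕ.* L) →
                 s ℕ.* d ℕ.^ (q ℕ.* q ℕ.+ (q ℕ.+ suc q)) ℕ.≤ C ℕ.* (u ℕ.^ (q ℕ.* q ℕ.+ (q ℕ.+ suc q)) ℕ.* L)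
      at-depth tree      e h = subst (λ k → s ℕ.* d ℕ.^ k ℕ.≤ C ℕ.* (u ℕ.^ k ℕ.* L))
        (trans (cong suc e) (suc-breadth q)) (raise q q≥1 q≥9u q≥cC s L k h)
      at-depth path      e h = at-depth tree e h
      at-depth treedepth e h = subst (λ k → s ℕ.* d ℕ.^ k ℕ.≤ C ℕ.* (u ℕ.^ k ℕ.* L)) e h

module _ {κ : Kind} {M : DPTM} (families : ∀ p → Family κ M (suc p)) where

  in-family : ∀ a C {q N} (F : Family κ M q) → N ℕ.≤ q →
              (∀ (I : Instance κ) → N ℕ.≤ Instance.k I → N ℕ.≤ Instance.n I → ∀ c → Reachable M (Instance.encoding I) c →
               fromℕ (space M c) ≤ fromℕ C * exponentialTimesLog a (Instance.k I) (Instance.n I)) →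
              ∀ i c → Reachable M (Instance.encoding (Family.instance-at F i)) c →
              fromℕ (space M c) ≤ fromℕ C * (a ^ Family.k F * fromℕ ⌈log₂ Family.n F ⌉)
  in-family a C {q} F N≤q bound i c r =
    subst₂ (λ k n → fromℕ (space M c) ≤ fromℕ C * exponentialTimesLog a k n) (k≡ i) (n≡ i)
      (bound (instance-at i)
        (ℕ.≤-trans N≤q (ℕ.≤-trans (breadth-≥ κ q) (ℕ.≤-reflexive (sym (trans (k≡ i) k-breadth)))))
        (ℕ.≤-trans N≤q (ℕ.≤-trans n-≥ (ℕ.≤-reflexive (sym (n≡ i)))))
        c r)
    where open Family F

  -- The base 2 - ε is negative when ε exceeds 2, and then only the sign matters. Base zero goes
  -- with the positive ones and is raised to one there.
  unbounded : ∀ a → a < 1ℚ + 1ℚ → ¬ SpaceO (exponentialTimesLog a) κ M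
  unbounded a@(mkℚ -[1+ _ ] _ _) _ (C , N , bound) =
    negative-contradiction κ M F C a (in-family a C F (choose-≥ κ N) bound) (ℚ.<⇒≤ (ℚ.negative⁻¹ a)) (breadth-odd κ N)
    where
    F = families (choose κ N)
  unbounded a@(mkℚ (+ u) d-1 coprime) (ℚ.*<* l) (C , N , bound) = nonnegative-contradiction κ M F C u d-1 coprime
    (in-family a C F (ℕ.≤-trans (ℕ.m≤m+n N _) (ℕ.n≤1+n _)) bound)
    (ℤ.drop‿+<+ (subst₂ ℤ._<_ (ℤ.*-identityʳ (+ u)) (sym (ℤ.pos-* 2 (suc d-1))) l))
    (s≤s z≤n)
    (ℕ.≤-trans (ℕ.m≤m+n _ (exponent M ℕ.* suc C)) (ℕ.≤-trans (ℕ.m≤n+m _ N) (ℕ.n≤1+n _)))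
    (ℕ.≤-trans (ℕ.m≤n+m _ ((u ⊔ suc d-1) ℕ.* 9)) (ℕ.≤-trans (ℕ.m≤n+m _ N) (ℕ.n≤1+n _)))
    where
    -- The sum makes q at least the threshold `N` of the bound and both lower bounds on q from
    -- `Asymptotics`.
    F = families (N ℕ.+ ((u ⊔ suc d-1) ℕ.* 9 ℕ.+ exponent M ℕ.* suc C))

theorem3p5 : (κ : Kind) (ε : ℚ) → 0ℚ < ε → (M : DPTM) → Solves VertexCover κ M →
    ¬ SpaceO (exponentialTimesLog ((1ℚ + 1ℚ) - ε)) κ M
theorem3p5 κ ε 0<ε M solves = unbounded (family κ M solves) ((1ℚ + 1ℚ) - ε)
  (subst ((1ℚ + 1ℚ) - ε <_) (ℚ.+-identityʳ (1ℚ + 1ℚ)) (ℚ.+-monoʳ-< (1ℚ + 1ℚ) (ℚ.neg-antimono-< 0<ε)))
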